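{- Let $G=(V,E)$ be a finite graph, with multiple edges and loops allowed, whose edge set $E$ is linearly ordered, and let $\mathcal{B}_G$ be its broken circuit complex with respect to this order. Then $$A_G(V)=\sum_{S\in\mathcal{B}_G}\ \prod_{C\in\mathcal{C}(S)}v_C .$$
   Context: Graphs are finite and may have multiple edges and loops. An orientation of $G$ assigns a direction to each edge; it is acyclic if it has no directed cycles (so a graph with a loop has no acyclic orientation). $\mathcal{A}(G)$ is the set of acyclic orientations of $G$. For $\mathfrak{o}\in\mathcal{A}(G)$, a vertex $v$ is a sink if every edge incident with $v$ is directed toward $v$ (in particular, isolated vertices are sinks); $\operatorname{Sink}(\mathfrak{o})$ is the set of sinks of $\mathfrak{o}$. To each vertex $v\in V$ associate a commuting variable, also denoted $v$, and let $\mathbb{Z}[V]$ be the polynomial ring in these variables. The acyclic orientation polynomial of $G$ is $$A_G(V)=\sum_{\mathfrak{o}\in\mathcal{A}(G)}\ \prod_{v\in\operatorname{Sink}(\mathfrak{o})}v\ \in\mathbb{Z}[V].$$ A subset $S\subseteq E$ is identified with the spanning subgraph of $G$ with vertex set $V$ and edge set $S$, and $\mathcal{C}(S)$ is its set of connected components. For a connected component $C$ with vertex set $V(C)$, put $$v_C=1-\prod_{v\in V(C)}(1-v)\in\mathbb{Z}[V].$$ A broken circuit is (the edge set of) a cycle of $G$ with its smallest edge removed; here a loop is a cycle of length 1 (giving the empty broken circuit) and two parallel edges form a cycle of length 2. The broken circuit complex $\mathcal{B}_G$ is the collection of all spanning subgraphs $S\subseteq E$ which do not contain a broken circuit. -}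

module Defs where

open import Data.Bool using (Bool; true; false; if_then_else_)
import Data.Bool.Properties as Bool
open import Data.Empty using (⊥-elim)
open import Data.Fin using (Fin; zero; suc; _≤_; _≤?_)
import Data.Fin.Properties as Fin
open import Data.Fin.Subset using (Subset; _∈_; _⊆_; _-_; ⁅_⁆; ⋃; Nonempty)
open import Data.Fin.Subset.Properties using (_∈?_; _⊆?_; nonempty?; anySubset?)
open import Data.Integer using (ℤ; 0ℤ; 1ℤ)
import Data.Integer as ℤ
open import Data.List using (List; []; _∷_; _++_; map; filter; foldr; length; allFin;
  cartesianProductWith)
import Data.List as List
open import Data.List.Properties using (length-map)
import Data.List.Membership.Propositional as List∈
open import Data.List.Membership.Propositional.Properties using (∈-lookup)
import Data.List.Membership.DecPropositional as DecList∈
open import Data.List.Relation.Unary.All using (All; []; _∷_)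
import Data.List.Relation.Unary.All as All
open import Data.List.Relation.Unary.All.Properties using (¬Any⇒All¬)
open import Data.List.Relation.Unary.Any using (here; there)
open import Data.List.Relation.Unary.AllPairs using ([]; _∷_)
open import Data.List.Relation.Unary.Unique.Propositional using (Unique)
import Data.List.Relation.Unary.Unique.DecPropositional as DecUnique
open import Data.Nat using (ℕ; zero; suc; z≤n; s≤s)
import Data.Nat as ℕ
import Data.Nat.Properties as ℕ
open import Data.Product using (∃; ∃₂; _×_; _,_; proj₁; proj₂; swap)
import Data.Product.Properties as Product
open import Data.Sum using (_⊎_; inj₁; inj₂)
open import Data.Unit using (tt)
open import Data.Vec using (Vec; []; _∷_)
import Data.Vec as Vec
import Data.Vec.Properties as Vec
open import Function using (_⇔_; mk⇔; Equivalence)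
open import Relation.Binary.PropositionalEquality using (_≡_; refl; sym; cong; subst)
open import Relation.Nullary using (Dec; yes; no; ¬_; ¬?; _×-dec_; _⊎-dec_; _→-dec_)
open import Relation.Nullary.Decidable using (does; map′)

private
  variable
    n m k : ℕ
    A : Set

-- A monomial is its vector of exponents.
Monomial : ℕ → Set
Monomial n = Vec ℕ n

-- A polynomial is a formal sum of integer multiples of monomials.  Repeated
-- monomials and zero terms are allowed, so the equality of the ring is _≈_.
Poly : ℕ → Set
Poly n = List (ℤ × Monomial n)

_≟ᴹ_ : (a b : Monomial n) → Dec (a ≡ b)
_≟ᴹ_ = Vec.≡-dec ℕ._≟_

coeff : Poly n → Monomial n → ℤ
coeff []            a = 0ℤ
coeff ((c , b) ∷ p) a = (if does (b ≟ᴹ a) then c else 0ℤ) ℤ.+ coeff p a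

infix 4 _≈_
_≈_ : Poly n → Poly n → Set
p ≈ q = ∀ a → coeff p a ≡ coeff q a

infixl 6 _+ᴾ_ _-ᴾ_
infixl 7 _*ᴾ_

0ᴾ 1ᴾ : Poly n
0ᴾ = []
1ᴾ = (1ℤ , Vec.replicate _ 0) ∷ []

var : Fin n → Poly n
var v = (1ℤ , (Vec.replicate _ 0 Vec.[ v ]≔ 1)) ∷ []

_+ᴾ_ _-ᴾ_ _*ᴾ_ : Poly n → Poly n → Poly n
p +ᴾ q = p ++ q
p -ᴾ q = p ++ map (λ (c , a) → ℤ.- c , a) q
p *ᴾ q = cartesianProductWith (λ (c , a) (d , b) → c ℤ.* d , Vec.zipWith ℕ._+_ a b) p q

∑[_]_ ∏[_]_ : List A → (A → Poly n) → Poly n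
∑[ xs ] f = foldr (λ x p → f x +ᴾ p) 0ᴾ xs
∏[ xs ] f = foldr (λ x p → f x *ᴾ p) 1ᴾ xs

-- The vertices are Fin n, and the edges are Fin m with its usual linear order.
-- The order of the two endpoints of an edge is only a reference direction.
record Graph (n m : ℕ) : Set where
  field
    endpoints : Fin m → Fin n × Fin n

open Graph public

Joins : Graph n m → Fin m → Fin n → Fin n → Set
Joins G e u v = endpoints G e ≡ (u , v) ⊎ endpoints G e ≡ (v , u)

Incident : Graph n m → Fin m → Fin n → Set
Incident G e v = v ≡ proj₁ (endpoints G e) ⊎ v ≡ proj₂ (endpoints G e)

-- Each step of a walk records the edge traversed and the vertex arrived at.
-- The relation R e u w says that the edge e may be traversed from u to w.
Steps : ℕ → ℕ → Set
Steps n m = List (Fin m × Fin n)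

edges : Steps n m → List (Fin m)
edges = map proj₁

vertices : Steps n m → List (Fin n)
vertices = map proj₂

Walk : (Fin m → Fin n → Fin n → Set) → Fin n → Steps n m → Fin n → Set
Walk R u []            v = u ≡ v
Walk R u ((e , w) ∷ s) v = R e u w × Walk R w s v

-- In a closed walk the base point v is the last vertex arrived at, so
-- vertices s lists every vertex of the cycle.  Distinctness of the edges
-- matters only for length 2, where the cycle must use two parallel edges.
IsCycle : (Fin m → Fin n → Fin n → Set) → Fin n → Steps n m → Set
IsCycle R v s =
  0 ℕ.< length s × Walk R v s v × Unique (edges s) × Unique (vertices s)

-- The value true orients an edge along its reference direction.
Orientation : ℕ → Set
Orientation m = Vec Bool m

arc : Graph n m → Orientation m → Fin m → Fin n × Fin n
arc G o e = if Vec.lookup o e then endpoints G e else swap (endpoints G e)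

Directed : Graph n m → Orientation m → Fin m → Fin n → Fin n → Set
Directed G o e u v = arc G o e ≡ (u , v)

Acyclic : Graph n m → Orientation m → Set
Acyclic G o = ¬ (∃₂ λ v s → IsCycle (Directed G o) v s)

IsSink : Graph n m → Orientation m → Fin n → Set
IsSink G o v = ∀ e → Incident G e v → proj₂ (arc G o e) ≡ v

JoinsIn : Graph n m → Subset m → Fin m → Fin n → Fin n → Set
JoinsIn G S e u v = e ∈ S × Joins G e u v

Connected : Graph n m → Subset m → Fin n → Fin n → Set
Connected G S u v = ∃ λ s → Walk (JoinsIn G S) u s v

-- A component enters the identity only through its vertex set C, which also
-- determines it within the spanning subgraph S.
IsComponent : Graph n m → Subset m → Subset n → Set
IsComponent G S C = Nonempty C × (∀ u → u ∈ C → ∀ w → w ∈ C ⇔ Connected G S u w)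

IsBrokenCircuit : Graph n m → Subset m → Set
IsBrokenCircuit G B = ∃₂ λ v s → IsCycle (Joins G) v s ×
  (∃ λ e → e List∈.∈ edges s × All (e ≤_) (edges s) × B ≡ ⋃ (map ⁅_⁆ (edges s)) - e)

InBrokenCircuitComplex : Graph n m → Subset m → Set
InBrokenCircuitComplex G S = ∀ B → IsBrokenCircuit G B → ¬ (B ⊆ S)

lookup-injective : {xs : List A} → Unique xs → ∀ i j → List.lookup xs i ≡ List.lookup xs j → i ≡ j
lookup-injective (x≢ ∷ u) zero    zero    eq = refl
lookup-injective (x≢ ∷ u) zero    (suc j) eq = ⊥-elim (All.lookup x≢ (∈-lookup j) eq)
lookup-injective (x≢ ∷ u) (suc i) zero    eq = ⊥-elim (All.lookup x≢ (∈-lookup i) (sym eq))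
lookup-injective (x≢ ∷ u) (suc i) (suc j) eq = cong suc (lookup-injective u i j eq)

unique⇒length≤ : {xs : List (Fin k)} → Unique xs → length xs ℕ.≤ k
unique⇒length≤ u = Fin.injective⇒≤ (λ {i} {j} → lookup-injective u i j)

anySteps? : ∀ k {P : Steps n m → Set} → (∀ s → Dec (P s)) → Dec (∃ λ s → length s ℕ.≤ k × P s)
anySteps? zero P? = map′ (λ p → [] , z≤n , p) (λ { ([] , _ , p) → p }) (P? [])
anySteps? (suc k) {P} P? = map′ to from
  (P? [] ⊎-dec Fin.any? λ e → Fin.any? λ v → anySteps? k λ s → P? ((e , v) ∷ s))
  where
  Rest = ∃ λ e → ∃ λ v → ∃ λ s → length s ℕ.≤ k × P ((e , v) ∷ s)
  to : P [] ⊎ Rest → ∃ λ s → length s ℕ.≤ suc k × P s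
  to (inj₁ p)                   = [] , z≤n , p
  to (inj₂ (e , v , s , l , p)) = (e , v) ∷ s , s≤s l , p
  from : (∃ λ s → length s ℕ.≤ suc k × P s) → P [] ⊎ Rest
  from ([] , _ , p)              = inj₁ p
  from ((e , v) ∷ s , s≤s l , p) = inj₂ (e , v , s , l , p)

module _ {R : Fin m → Fin n → Fin n → Set} (R? : ∀ e u v → Dec (R e u v)) where

  walk? : ∀ u s v → Dec (Walk R u s v)
  walk? u []            v = u Fin.≟ v
  walk? u ((e , w) ∷ s) v = R? e u w ×-dec walk? w s v

  isCycle? : ∀ v s → Dec (IsCycle R v s)
  isCycle? v s = (0 ℕ.<? length s) ×-dec walk? v s v ×-dec
    DecUnique.unique? Fin._≟_ (edges s) ×-dec DecUnique.unique? Fin._≟_ (vertices s)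

  anyCycle? : {P : Steps n m → Set} → (∀ s → Dec (P s)) → Dec (∃₂ λ v s → IsCycle R v s × P s)
  anyCycle? P? = map′ (λ (v , s , _ , p) → v , s , p) (λ (v , s , p) → v , s , bound s p , p)
    (Fin.any? λ v → anySteps? m λ s → isCycle? v s ×-dec P? s)
    where
    bound : ∀ {v} {Q : Set} s → IsCycle R v s × Q → length s ℕ.≤ m
    bound s ((_ , _ , u , _) , _) = subst (ℕ._≤ m) (length-map proj₁ s) (unique⇒length≤ u)

  Path : Fin n → Fin n → Set
  Path u v = ∃ λ s → Walk R u s v × Unique (u ∷ vertices s)

  suffix : ∀ {u w v} s → Walk R w s v → Unique (w ∷ vertices s) → u List∈.∈ w ∷ vertices s → Path u v
  suffix s             p       q       (here refl) = s , p , q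
  suffix ((e , x) ∷ s) (_ , p) (_ ∷ q) (there i)   = suffix s p q i

  walk⇒path : ∀ {u v} s → Walk R u s v → Path u v
  walk⇒path []            refl    = [] , refl , [] ∷ []
  walk⇒path {u} ((e , w) ∷ s) (r , p) with walk⇒path s p
  ... | s′ , p′ , q with DecList∈._∈?_ Fin._≟_ u (w ∷ vertices s′)
  ...   | yes i = suffix s′ p′ q i
  ...   | no ¬i = (e , w) ∷ s′ , (r , p′) , ¬Any⇒All¬ _ ¬i ∷ q

  anyWalk? : ∀ u v → Dec (∃ λ s → Walk R u s v)
  anyWalk? u v = map′ (λ (s , _ , p) → s , p) shorten (anySteps? n λ s → walk? u s v)
    where
    shorten : (∃ λ s → Walk R u s v) → ∃ λ s → length s ℕ.≤ n × Walk R u s v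
    shorten (s , p) with walk⇒path s p
    ... | s′ , p′ , (_ ∷ q) = s′ , subst (ℕ._≤ n) (length-map proj₂ s′) (unique⇒length≤ q) , p′

module _ (G : Graph n m) where

  _≟ᴱ_ : (x y : Fin n × Fin n) → Dec (x ≡ y)
  _≟ᴱ_ = Product.≡-dec Fin._≟_ Fin._≟_

  joins? : ∀ e u v → Dec (Joins G e u v)
  joins? e u v = (endpoints G e ≟ᴱ (u , v)) ⊎-dec (endpoints G e ≟ᴱ (v , u))

  acyclic? : ∀ o → Dec (Acyclic G o)
  acyclic? o = ¬? (map′ (λ (v , s , c , _) → v , s , c) (λ (v , s , c) → v , s , c , tt)
    (anyCycle? (λ e u v → arc G o e ≟ᴱ (u , v)) (λ _ → yes tt)))

  isSink? : ∀ o v → Dec (IsSink G o v)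
  isSink? o v = Fin.all? λ e →
    ((v Fin.≟ proj₁ (endpoints G e)) ⊎-dec (v Fin.≟ proj₂ (endpoints G e)))
      →-dec (proj₂ (arc G o e) Fin.≟ v)

  connected? : ∀ S u v → Dec (Connected G S u v)
  connected? S = anyWalk? λ e u v → (e ∈? S) ×-dec joins? e u v

  isComponent? : ∀ S C → Dec (IsComponent G S C)
  isComponent? S C = nonempty? C ×-dec
    Fin.all? λ u → (u ∈? C) →-dec Fin.all? λ w → map′
      (λ (f , g) → mk⇔ f g) (λ eq → Equivalence.to eq , Equivalence.from eq)
      (((w ∈? C) →-dec connected? S u w) ×-dec (connected? S u w →-dec (w ∈? C)))

  isBrokenCircuit? : ∀ B → Dec (IsBrokenCircuit G B)
  isBrokenCircuit? B = anyCycle? joins? λ s → Fin.any? λ e →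
    DecList∈._∈?_ Fin._≟_ e (edges s) ×-dec All.all? (e ≤?_) (edges s) ×-dec
    Vec.≡-dec Bool._≟_ B (⋃ (map ⁅_⁆ (edges s)) - e)

  inBrokenCircuitComplex? : ∀ S → Dec (InBrokenCircuitComplex G S)
  inBrokenCircuitComplex? S = map′
    (λ ¬p B b B⊆S → ¬p (B , b , λ {x} → B⊆S {x})) (λ f (B , b , B⊆S) → f B b (λ {x} → B⊆S {x}))
    (¬? (anySubset? λ B → isBrokenCircuit? B ×-dec (B ⊆? S)))

-- Every Boolean vector, listed once; these are both the subsets of Fin k
-- and the orientations of k edges.
allBoolVecs : ∀ k → List (Vec Bool k)
allBoolVecs zero    = [] ∷ []
allBoolVecs (suc k) = cartesianProductWith _∷_ (true ∷ false ∷ []) (allBoolVecs k)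

module _ (G : Graph n m) where

  acyclicOrientations : List (Orientation m)
  acyclicOrientations = filter (acyclic? G) (allBoolVecs m)

  Sink : Orientation m → List (Fin n)
  Sink o = filter (isSink? G o) (allFin n)

  acyclicOrientationPolynomial : Poly n
  acyclicOrientationPolynomial = ∑[ acyclicOrientations ] λ o → ∏[ Sink o ] var

  brokenCircuitComplex : List (Subset m)
  brokenCircuitComplex = filter (inBrokenCircuitComplex? G) (allBoolVecs m)

  components : Subset m → List (Subset n)
  components S = filter (isComponent? G S) (allBoolVecs n)

-- This is v_C = 1 - ∏_{v ∈ C} (1 - v).
componentWeight : Subset n → Poly n
componentWeight C = 1ᴾ -ᴾ ∏[ filter (_∈? C) (allFin _) ] λ v → 1ᴾ -ᴾ var v

{-# OPTIONS --safe #-}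

-- The proof is deletion–contraction, carried out orientation by orientation.  Let
-- e = uv be an edge and fix contractions and orientations of other edges, for which
-- u and v are not yet identified.  If v reaches u or u reaches v, exactly one
-- orientation of e can be acyclic, contracting e is not acyclic, and orienting e
-- creates or destroys no sink, so it has the weight of deleting e.  Otherwise both
-- orientations, the contraction and the deletion share their acyclicity, and the
-- weights agree because v_{C ∪ D} + v_C v_D = v_C + v_D for disjoint C and D.  If u
-- and v are already identified, neither orientation of e is acyclic.
--
-- Expanding all edges from the largest down to the smallest leaves one term for each
-- set S of contracted edges such that no edge e has its endpoints joined by edges of
-- S larger than e.  A path of such edges closes up with e to a cycle with smallest
-- edge e, so these are the sets S that contain no broken circuit.

module Submission where

open import Defs
open import Data.Nat using (ℕ)
open import Algebra.Bundles using (CommutativeMonoid; CommutativeRing)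
import Algebra.Properties.CommutativeSemigroup as CommutativeSemigroupProperties
import Algebra.Properties.Ring as RingProperties
open import Data.Bool using (Bool; true; false; if_then_else_)
import Data.Bool.Properties as Bool
open import Data.Empty using (⊥-elim)
open import Data.Fin using (Fin; zero; suc; _<_)
import Data.Fin.Properties as Fin
import Data.Fin.Subset as Subset
open import Data.Fin.Subset using (Subset; ⁅_⁆; ⊥; ⋃; _∈_; _∉_; _∪_; _⊆_; Nonempty)
open import Data.Fin.Subset.Properties using (_∈?_; nonempty?; ∉⊥; x∈⁅x⁆; x∈⁅y⁆⇒x≡y; x∈p∪q⁻; x∈p∪q⁺; ⊆-antisym; x∈p∧x≢y⇒x∈p-y; p─q⊆p)
open import Data.Integer using (ℤ; 0ℤ; 1ℤ)
import Data.Integer as ℤ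
import Data.Integer.Properties as ℤ
open import Data.List using (List; []; _∷_; _++_; map; filter; foldr; allFin)
open import Data.List.Properties using (map-tabulate; ++-identityʳ)
import Data.List.Membership.DecPropositional as DecMembership
open import Data.List.Membership.Propositional using () renaming (_∈_ to _∈ₗ_; _∉_ to _∉ₗ_)
open import Data.List.Membership.Propositional.Properties using (∈-allFin; ∈-cartesianProductWith⁺)
open import Data.List.Relation.Unary.All using (All; []; _∷_)
import Data.List.Relation.Unary.All as All
open import Data.List.Relation.Unary.AllPairs using ([]; _∷_)
open import Data.List.Relation.Unary.Any using (here; there)
open import Data.List.Relation.Unary.Unique.Propositional using (Unique)
import Data.List.Relation.Unary.Unique.Propositional.Properties as Unique
open import Data.Nat using (zero; suc; z≤n; s≤s; z<s; s<s; s<s⁻¹)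
import Data.Nat as ℕ
import Data.Nat.Properties as ℕ
open import Data.Product using (∃; ∃₂; _×_; _,_; proj₁; proj₂; swap)
import Data.Product.Properties as Product
open import Data.Sum using (_⊎_; inj₁; inj₂; [_,_]′)
open import Data.Unit using (⊤; tt)
open import Data.Vec using (Vec; []; _∷_; here; there)
import Data.Vec as Vec
import Data.Vec.Properties as Vec
open import Function using (_∘_; id; _⇔_; mk⇔; Equivalence)
open import Level using (0ℓ)
open import Relation.Binary.Construct.Closure.ReflexiveTransitive using (Star; ε; _◅_; _◅◅_)
import Relation.Binary.Construct.Closure.ReflexiveTransitive as Star
open import Relation.Binary.Definitions using (DecidableEquality)
open import Relation.Binary.PropositionalEquality as ≡ using (_≡_; _≢_; cong)
import Relation.Binary.Reasoning.Setoid as SetoidReasoning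
open import Relation.Nullary using (Dec; yes; no; ¬_; ¬?; _×-dec_; _⊎-dec_; _→-dec_)
open import Relation.Nullary.Decidable using (does; dec-true; dec-false; does-⇔; map′)
open import Relation.Nullary.Reflects using (Reflects; invert)

private
  variable
    n m : ℕ
    X Y : Set

-- The polynomial ring under equality of all pairings.

-- A polynomial is determined by its pairing with all functions on monomials;
-- in this form the product is visibly bilinear, and _≈_ is the special case
-- of indicator functions.
⟦_⟧ : Poly n → (Monomial n → ℤ) → ℤ
⟦ []          ⟧ φ = 0ℤ
⟦ (c , b) ∷ p ⟧ φ = c ℤ.* φ b ℤ.+ ⟦ p ⟧ φ

infix 4 _≋_
-- Wrapping the pairings in a record keeps `p` and `q` visible in the type, from which they can be
-- inferred.
record _≋_ (p q : Poly n) : Set where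
  constructor mk≋
  field
    pairing : ∀ φ → ⟦ p ⟧ φ ≡ ⟦ q ⟧ φ
open _≋_

infixl 6 _⊕_
_⊕_ : Monomial n → Monomial n → Monomial n
_⊕_ = Vec.zipWith ℕ._+_

module _ where
  open CommutativeSemigroupProperties ℤ.+-commutativeSemigroup using (interchange)
  open ≡ using (refl; sym; trans; cong₂)
  open ≡.≡-Reasoning

  private
    variable
      φ ψ : Monomial n → ℤ

  ⟦⟧-cong : ∀ (p : Poly n) → (∀ a → φ a ≡ ψ a) → ⟦ p ⟧ φ ≡ ⟦ p ⟧ ψ
  ⟦⟧-cong []            eq = refl
  ⟦⟧-cong ((c , b) ∷ p) eq = cong₂ ℤ._+_ (cong (c ℤ.*_) (eq b)) (⟦⟧-cong p eq)

  ⟦⟧-zero : ∀ (p : Poly n) → ⟦ p ⟧ (λ _ → 0ℤ) ≡ 0ℤ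
  ⟦⟧-zero []            = refl
  ⟦⟧-zero ((c , b) ∷ p) = cong₂ ℤ._+_ (ℤ.*-zeroʳ c) (⟦⟧-zero p)

  -- Scaling and addition are treated together because pairing with `(c , b) ∷ p` produces exactly
  -- this shape in the induction of `⟦⟧-fubini`.
  ⟦⟧-linear : ∀ (p : Poly n) c →
    ⟦ p ⟧ (λ a → c ℤ.* φ a ℤ.+ ψ a) ≡ c ℤ.* ⟦ p ⟧ φ ℤ.+ ⟦ p ⟧ ψ
  ⟦⟧-linear [] c = sym (trans (ℤ.+-identityʳ _) (ℤ.*-zeroʳ c))
  ⟦⟧-linear {φ = φ} {ψ} ((d , b) ∷ p) c = begin
    d ℤ.* (c ℤ.* φ b ℤ.+ ψ b) ℤ.+ ⟦ p ⟧ (λ a → c ℤ.* φ a ℤ.+ ψ a)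
      ≡⟨ cong₂ ℤ._+_ (ℤ.*-distribˡ-+ d _ _) (⟦⟧-linear p c) ⟩
    (d ℤ.* (c ℤ.* φ b) ℤ.+ d ℤ.* ψ b) ℤ.+ (c ℤ.* ⟦ p ⟧ φ ℤ.+ ⟦ p ⟧ ψ)
      ≡⟨ interchange (d ℤ.* (c ℤ.* φ b)) _ _ _ ⟩
    (d ℤ.* (c ℤ.* φ b) ℤ.+ c ℤ.* ⟦ p ⟧ φ) ℤ.+ (d ℤ.* ψ b ℤ.+ ⟦ p ⟧ ψ)
      ≡⟨ cong (λ z → z ℤ.+ c ℤ.* ⟦ p ⟧ φ ℤ.+ _) (*-swap d c (φ b)) ⟩
    (c ℤ.* (d ℤ.* φ b) ℤ.+ c ℤ.* ⟦ p ⟧ φ) ℤ.+ (d ℤ.* ψ b ℤ.+ ⟦ p ⟧ ψ)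
      ≡⟨ cong (ℤ._+ _) (ℤ.*-distribˡ-+ c _ _) ⟨
    c ℤ.* (d ℤ.* φ b ℤ.+ ⟦ p ⟧ φ) ℤ.+ (d ℤ.* ψ b ℤ.+ ⟦ p ⟧ ψ) ∎
    where open CommutativeSemigroupProperties ℤ.*-commutativeSemigroup
            using () renaming (x∙yz≈y∙xz to *-swap)

  ⟦⟧-++ : ∀ (p q : Poly n) → ⟦ p +ᴾ q ⟧ φ ≡ ⟦ p ⟧ φ ℤ.+ ⟦ q ⟧ φ
  ⟦⟧-++ []      q = sym (ℤ.+-identityˡ _)
  ⟦⟧-++ {φ = φ} ((c , b) ∷ p) q =
    trans (cong (ℤ._+_ (c ℤ.* φ b)) (⟦⟧-++ p q)) (sym (ℤ.+-assoc (c ℤ.* φ b) _ _))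

  ⟦⟧-neg : ∀ (p : Poly n) → ⟦ 0ᴾ -ᴾ p ⟧ φ ≡ ℤ.- ⟦ p ⟧ φ
  ⟦⟧-neg []            = refl
  ⟦⟧-neg ((c , b) ∷ p) = trans
    (cong₂ ℤ._+_ (sym (ℤ.neg-distribˡ-* c _)) (⟦⟧-neg p)) (sym (ℤ.neg-distrib-+ (c ℤ.* _) _))

  ⟦⟧-term : ∀ c (b : Monomial n) q →
    ⟦ map (λ (d , a) → c ℤ.* d , b ⊕ a) q ⟧ φ ≡ c ℤ.* ⟦ q ⟧ (λ a → φ (b ⊕ a))
  ⟦⟧-term c b []            = sym (ℤ.*-zeroʳ c)
  ⟦⟧-term c b ((d , a) ∷ q) = trans
    (cong₂ ℤ._+_ (ℤ.*-assoc c d _) (⟦⟧-term c b q)) (sym (ℤ.*-distribˡ-+ c _ _))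

  ⟦⟧-* : ∀ (p q : Poly n) → ⟦ p *ᴾ q ⟧ φ ≡ ⟦ p ⟧ (λ b → ⟦ q ⟧ (λ a → φ (b ⊕ a)))
  ⟦⟧-* []            q = refl
  ⟦⟧-* ((c , b) ∷ p) q =
    trans (⟦⟧-++ (map _ q) (p *ᴾ q)) (cong₂ ℤ._+_ (⟦⟧-term c b q) (⟦⟧-* p q))

  -- Together with the commutativity of `_⊕_`, this exchange of two finite sums makes multiplication
  -- commutative.
  ⟦⟧-fubini : ∀ (p q : Poly n) (χ : Monomial n → Monomial n → ℤ) →
    ⟦ p ⟧ (λ b → ⟦ q ⟧ (χ b)) ≡ ⟦ q ⟧ (λ a → ⟦ p ⟧ (λ b → χ b a))
  ⟦⟧-fubini []            q χ = sym (⟦⟧-zero q)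
  ⟦⟧-fubini ((c , b) ∷ p) q χ =
    trans (cong (ℤ._+_ (c ℤ.* ⟦ q ⟧ (χ b))) (⟦⟧-fubini p q χ)) (sym (⟦⟧-linear q c))

  coeff≡⟦⟧ : ∀ (p : Poly n) a →
    coeff p a ≡ ⟦ p ⟧ (λ b → if does (b ≟ᴹ a) then 1ℤ else 0ℤ)
  coeff≡⟦⟧ []            a = refl
  coeff≡⟦⟧ ((c , b) ∷ p) a = cong₂ ℤ._+_ (scale (does (b ≟ᴹ a))) (coeff≡⟦⟧ p a)
    where
    scale : ∀ t → (if t then c else 0ℤ) ≡ c ℤ.* (if t then 1ℤ else 0ℤ)
    scale true  = sym (ℤ.*-identityʳ c)
    scale false = sym (ℤ.*-zeroʳ c)

  ≋⇒≈ : {p q : Poly n} → p ≋ q → p ≈ q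
  ≋⇒≈ {p = p} {q} eq a = trans (coeff≡⟦⟧ p a) (trans (pairing eq _) (sym (coeff≡⟦⟧ q a)))

  -- Negation is `0ᴾ -ᴾ p`, so that subtraction in the ring unfolds to the given `_-ᴾ_`.
  polyRing : ℕ → CommutativeRing 0ℓ 0ℓ
  polyRing n = record
    { Carrier = Poly n ; _≈_ = _≋_ ; _+_ = _+ᴾ_ ; _*_ = _*ᴾ_ ; -_ = λ p → 0ᴾ -ᴾ p ; 0# = 0ᴾ ; 1# = 1ᴾ
    ; isCommutativeRing = record
      { isRing = record
        { +-isAbelianGroup = record
          { isGroup = record
            { isMonoid = record
              { isSemigroup = record
                { isMagma = record
                  { isEquivalence = record
                    { refl = mk≋ λ _ → refl
                    ; sym = λ e → mk≋ λ φ → sym (pairing e φ)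
                    ; trans = λ e f → mk≋ λ φ → trans (pairing e φ) (pairing f φ) }
                  ; ∙-cong = λ {p} {q} {r} {s} e f → mk≋ λ φ → trans (⟦⟧-++ p r)
                      (trans (cong₂ ℤ._+_ (pairing e φ) (pairing f φ)) (sym (⟦⟧-++ q s))) }
                ; assoc = λ p q r → mk≋ λ φ → trans (trans (⟦⟧-++ (p +ᴾ q) r) (cong (ℤ._+ _) (⟦⟧-++ p q)))
                    (trans (ℤ.+-assoc (⟦ p ⟧ φ) _ _)
                      (sym (trans (⟦⟧-++ p (q +ᴾ r)) (cong (ℤ._+_ (⟦ p ⟧ φ)) (⟦⟧-++ q r))))) }
              ; identity = (λ _ → mk≋ λ _ → refl) ,
                  λ p → mk≋ λ φ → trans (⟦⟧-++ p 0ᴾ) (ℤ.+-identityʳ _) }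
            ; inverse =
                (λ p → mk≋ λ φ → trans (⟦⟧-++ (0ᴾ -ᴾ p) p)
                  (trans (cong (ℤ._+ ⟦ p ⟧ φ) (⟦⟧-neg p)) (ℤ.+-inverseˡ (⟦ p ⟧ φ)))) ,
                (λ p → mk≋ λ φ → trans (⟦⟧-++ p (0ᴾ -ᴾ p))
                  (trans (cong (ℤ._+_ (⟦ p ⟧ φ)) (⟦⟧-neg p)) (ℤ.+-inverseʳ (⟦ p ⟧ φ))))
            ; ⁻¹-cong = λ {p} {q} e → mk≋ λ φ →
                trans (⟦⟧-neg p) (trans (cong ℤ.-_ (pairing e φ)) (sym (⟦⟧-neg q))) }
          ; comm = λ p q → mk≋ λ φ →
              trans (⟦⟧-++ p q) (trans (ℤ.+-comm (⟦ p ⟧ φ) _) (sym (⟦⟧-++ q p))) }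
        ; *-cong = λ {p} {q} {r} {s} e f → mk≋ λ φ → trans (⟦⟧-* p r)
            (trans (⟦⟧-cong p λ b → pairing f _) (trans (pairing e _) (sym (⟦⟧-* q s))))
        ; *-assoc = λ p q r → mk≋ λ φ → trans (trans (⟦⟧-* (p *ᴾ q) r) (⟦⟧-* p q)) (sym
            (trans (⟦⟧-* p (q *ᴾ r)) (⟦⟧-cong p λ a → trans (⟦⟧-* q r)
              (⟦⟧-cong q λ b → ⟦⟧-cong r λ c → cong φ (sym (Vec.zipWith-assoc ℕ.+-assoc a b c))))))
        ; *-identity =
            (λ p → mk≋ λ φ → *-idˡ p φ) ,
            (λ p → mk≋ λ φ → trans (*-comm p 1ᴾ φ) (*-idˡ p φ))
        ; distrib =
            (λ p q r → mk≋ λ φ → trans (*-comm p (q +ᴾ r) φ) (trans (distribʳ p q r φ)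
              (trans (cong₂ ℤ._+_ (*-comm q p φ) (*-comm r p φ)) (sym (⟦⟧-++ (p *ᴾ q) (p *ᴾ r)))))) ,
            (λ p q r → mk≋ λ φ → trans (distribʳ p q r φ) (sym (⟦⟧-++ (q *ᴾ p) (r *ᴾ p)))) }
      ; *-comm = λ p q → mk≋ (*-comm p q) } }
    where
    *-comm : ∀ (p q : Poly n) φ → ⟦ p *ᴾ q ⟧ φ ≡ ⟦ q *ᴾ p ⟧ φ
    *-comm p q φ = begin
      ⟦ p *ᴾ q ⟧ φ                             ≡⟨ ⟦⟧-* p q ⟩
      ⟦ p ⟧ (λ b → ⟦ q ⟧ (λ a → φ (b ⊕ a)))   ≡⟨ ⟦⟧-fubini p q _ ⟩
      ⟦ q ⟧ (λ a → ⟦ p ⟧ (λ b → φ (b ⊕ a)))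
        ≡⟨ ⟦⟧-cong q (λ a → ⟦⟧-cong p λ b → cong φ (Vec.zipWith-comm ℕ.+-comm b a)) ⟩
      ⟦ q ⟧ (λ a → ⟦ p ⟧ (λ b → φ (a ⊕ b)))   ≡⟨ ⟦⟧-* q p ⟨
      ⟦ q *ᴾ p ⟧ φ                             ∎

    *-idˡ : ∀ (p : Poly n) φ → ⟦ 1ᴾ *ᴾ p ⟧ φ ≡ ⟦ p ⟧ φ
    *-idˡ p φ = trans (⟦⟧-* 1ᴾ p) (trans (ℤ.+-identityʳ _) (trans (ℤ.*-identityˡ _)
      (⟦⟧-cong p λ a → cong φ (Vec.zipWith-identityˡ ℕ.+-identityˡ a))))

    distribʳ : ∀ (p q r : Poly n) φ →
      ⟦ (q +ᴾ r) *ᴾ p ⟧ φ ≡ ⟦ q *ᴾ p ⟧ φ ℤ.+ ⟦ r *ᴾ p ⟧ φ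
    distribʳ p q r φ = trans (⟦⟧-* (q +ᴾ r) p)
      (trans (⟦⟧-++ q r) (cong₂ ℤ._+_ (sym (⟦⟧-* q p)) (sym (⟦⟧-* r p))))

-- Complements 1 - x in a commutative ring.

module Complement (R : CommutativeRing 0ℓ 0ℓ) where
  open CommutativeRing R renaming (_≈_ to _∼_)
  open RingProperties ring using (-‿distribʳ-*; -‿involutive; -‿+-comm)
  open SetoidReasoning setoid

  complement-+ : ∀ x → x + (1# - x) ∼ 1#
  complement-+ x = begin
    x + (1# - x)   ≈⟨ +-comm _ _ ⟩
    1# - x + x     ≈⟨ +-assoc _ _ _ ⟩
    1# + (- x + x) ≈⟨ +-congˡ (-‿inverseˡ x) ⟩
    1# + 0#        ≈⟨ +-identityʳ 1# ⟩
    1#             ∎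

  -- Write 1 - xy as (1 - x) + x(1 - y); the two multiples of 1 - y then add up to 1 - y, because x
  -- + (1 - x) = 1. With x and y the products of 1 - v over disjoint `C` and `D`, this is the
  -- identity between the weights of `C`, `D` and their union.
  complement-* : ∀ x y → (1# - x * y) + (1# - x) * (1# - y) ∼ (1# - x) + (1# - y)
  complement-* x y = begin
    (1# - x * y) + (1# - x) * (1# - y)              ≈⟨ +-congʳ telescope ⟨
    (1# - x) + x * (1# - y) + (1# - x) * (1# - y)   ≈⟨ +-assoc _ _ _ ⟩
    (1# - x) + (x * (1# - y) + (1# - x) * (1# - y)) ≈⟨ +-congˡ (distribʳ _ _ _) ⟨
    (1# - x) + (x + (1# - x)) * (1# - y)            ≈⟨ +-congˡ (*-congʳ (complement-+ x)) ⟩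
    (1# - x) + 1# * (1# - y)                        ≈⟨ +-congˡ (*-identityˡ _) ⟩
    (1# - x) + (1# - y)                             ∎
    where
    telescope : (1# - x) + x * (1# - y) ∼ 1# - x * y
    telescope = begin
      (1# - x) + x * (1# - y)         ≈⟨ +-congˡ (distribˡ x 1# (- y)) ⟩
      (1# - x) + (x * 1# + x * (- y)) ≈⟨ +-congˡ (+-cong (*-identityʳ x) (sym (-‿distribʳ-* x y))) ⟩
      (1# - x) + (x - x * y)          ≈⟨ +-assoc _ _ _ ⟨
      (1# - x) + x - x * y            ≈⟨ +-congʳ (trans (+-comm _ _) (complement-+ x)) ⟩
      1# - x * y                      ∎

  complement-cong : ∀ x y → x ∼ y → 1# - x ∼ 1# - y
  complement-cong x y eq = +-congˡ (-‿cong eq)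

  complement-union : ∀ p x y → p ∼ x * y → (1# - p) + (1# - x) * (1# - y) ∼ (1# - x) + (1# - y)
  complement-union p x y eq = trans (+-congʳ (complement-cong p (x * y) eq)) (complement-* x y)

  complement-involutive : ∀ x → 1# - (1# - x) ∼ x
  complement-involutive x = begin
    1# - (1# - x)          ≈⟨ +-congˡ (-‿+-comm 1# (- x)) ⟨
    1# + (- 1# + - (- x))  ≈⟨ +-assoc _ _ _ ⟨
    1# - 1# + - (- x)      ≈⟨ +-cong (-‿inverseʳ 1#) (-‿involutive x) ⟩
    0# + x                 ≈⟨ +-identityˡ x ⟩
    x                      ∎

-- Finite sums and products, in particular over all Boolean vectors.

allBoolVecs-complete : ∀ {k} (v : Vec Bool k) → v ∈ₗ allBoolVecs k
allBoolVecs-complete []      = here ≡.refl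
allBoolVecs-complete (b ∷ v) = ∈-cartesianProductWith⁺ _∷_ (member b) (allBoolVecs-complete v)
  where
  member : ∀ b → b ∈ₗ true ∷ false ∷ []
  member true  = here ≡.refl
  member false = there (here ≡.refl)

allBoolVecs-unique : ∀ k → Unique (allBoolVecs k)
allBoolVecs-unique zero    = [] ∷ []
allBoolVecs-unique (suc k) = Unique.cartesianProductWith⁺ _∷_ Vec.∷-injective
  (((λ ()) ∷ []) ∷ [] ∷ []) (allBoolVecs-unique k)

module _ {P X : Set} {x y : X} where

  if-yes : (d : Dec P) → P → (if does d then x else y) ≡ x
  if-yes d p = cong (if_then x else y) (dec-true d p)

  if-no : (d : Dec P) → ¬ P → (if does d then x else y) ≡ y
  if-no d ¬p = cong (if_then x else y) (dec-false d ¬p)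

module Fold (M : CommutativeMonoid 0ℓ 0ℓ) where
  open CommutativeMonoid M renaming (_≈_ to _∼_; ε to ι)
  open CommutativeSemigroupProperties commutativeSemigroup using (interchange; x∙yz≈y∙xz)
  open SetoidReasoning setoid

  fold : List X → (X → Carrier) → Carrier
  fold xs f = foldr (λ x p → f x ∙ p) ι xs

  fold-cong : ∀ (xs : List X) {f g : X → Carrier} → (∀ x → f x ∼ g x) → fold xs f ∼ fold xs g
  fold-cong []       eq = refl
  fold-cong (x ∷ xs) eq = ∙-cong (eq x) (fold-cong xs eq)

  fold-cong-∈ : ∀ (xs : List X) {f g : X → Carrier} →
    (∀ x → x ∈ₗ xs → f x ∼ g x) → fold xs f ∼ fold xs g
  fold-cong-∈ []       eq = refl
  fold-cong-∈ (x ∷ xs) eq = ∙-cong (eq x (here ≡.refl)) (fold-cong-∈ xs λ y y∈ → eq y (there y∈))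

  fold-ι : ∀ (xs : List X) → fold xs (λ _ → ι) ∼ ι
  fold-ι []       = refl
  fold-ι (x ∷ xs) = trans (identityˡ _) (fold-ι xs)

  fold-∙ : ∀ (xs : List X) {f g : X → Carrier} →
    fold xs (λ x → f x ∙ g x) ∼ fold xs f ∙ fold xs g
  fold-∙ []       = sym (identityˡ ι)
  fold-∙ (x ∷ xs) = trans (∙-congˡ (fold-∙ xs)) (interchange _ _ _ _)

  fold-++ : ∀ (xs ys : List X) {f : X → Carrier} → fold (xs ++ ys) f ∼ fold xs f ∙ fold ys f
  fold-++ []       ys = sym (identityˡ _)
  fold-++ (x ∷ xs) ys = trans (∙-congˡ (fold-++ xs ys)) (sym (assoc _ _ _))

  fold-map : ∀ (h : X → Y) xs {f : Y → Carrier} → fold (map h xs) f ∼ fold xs (f ∘ h)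
  fold-map h []       = refl
  fold-map h (x ∷ xs) = ∙-congˡ (fold-map h xs)

  fold-filter : ∀ {P : X → Set} (P? : ∀ x → Dec (P x)) xs {f : X → Carrier} →
    fold (filter P? xs) f ∼ fold xs (λ x → if does (P? x) then f x else ι)
  fold-filter P? []       = refl
  fold-filter P? (x ∷ xs) with does (P? x)
  ... | true  = ∙-congˡ (fold-filter P? xs)
  ... | false = trans (fold-filter P? xs) (sym (identityˡ _))

  -- Here `g` is `f` with its value at `x` made neutral, so one factor is split off without removing
  -- an entry from the list.
  fold-extract : ∀ {xs : List X} {x} {f g : X → Carrier} → Unique xs → x ∈ₗ xs →
    (∀ y → y ≢ x → f y ∼ g y) → g x ∼ ι → fold xs f ∼ f x ∙ fold xs g
  fold-extract {xs = x ∷ xs} {f = f} {g} (x∉ ∷ _) (here ≡.refl) eq gx = begin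
    f x ∙ fold xs f         ≈⟨ ∙-congˡ (fold-cong-∈ xs λ y y∈ → eq y (All.lookup x∉ y∈ ∘ ≡.sym)) ⟩
    f x ∙ fold xs g         ≈⟨ ∙-congˡ (identityˡ _) ⟨
    f x ∙ (ι ∙ fold xs g)   ≈⟨ ∙-congˡ (∙-congʳ gx) ⟨
    f x ∙ (g x ∙ fold xs g) ∎
  fold-extract {xs = y ∷ xs} {x} {f} {g} (y∉ ∷ u) (there x∈) eq gx = begin
    f y ∙ fold xs f         ≈⟨ ∙-cong (eq y (All.lookup y∉ x∈)) (fold-extract u x∈ eq gx) ⟩
    g y ∙ (f x ∙ fold xs g) ≈⟨ x∙yz≈y∙xz _ _ _ ⟩
    f x ∙ (g y ∙ fold xs g) ∎

  fold-single : ∀ {xs : List X} {x} {f : X → Carrier} → Unique xs → x ∈ₗ xs →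
    (∀ y → y ≢ x → f y ∼ ι) → fold xs f ∼ f x
  fold-single {xs = xs} u x∈ eq =
    trans (fold-extract u x∈ eq refl) (trans (∙-congˡ (fold-ι xs)) (identityʳ _))

  fold-allBoolVecs : ∀ k {f : Vec Bool (suc k) → Carrier} → fold (allBoolVecs (suc k)) f ∼
    fold (allBoolVecs k) (λ v → f (true ∷ v)) ∙ fold (allBoolVecs k) (λ v → f (false ∷ v))
  fold-allBoolVecs k {f} = begin
    fold (map (true ∷_) vs ++ map (false ∷_) vs ++ []) f
      ≈⟨ fold-++ (map (true ∷_) vs) (map (false ∷_) vs ++ []) ⟩
    fold (map (true ∷_) vs) f ∙ fold (map (false ∷_) vs ++ []) f
      ≡⟨ cong (λ l → fold (map (true ∷_) vs) f ∙ fold l f) (++-identityʳ (map (false ∷_) vs)) ⟩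
    fold (map (true ∷_) vs) f ∙ fold (map (false ∷_) vs) f
      ≈⟨ ∙-cong (fold-map (true ∷_) vs) (fold-map (false ∷_) vs) ⟩
    fold vs (λ v → f (true ∷ v)) ∙ fold vs (λ v → f (false ∷ v)) ∎
    where
    vs = allBoolVecs k

  -- Among the subsets containing `zero` only the singleton contributes; the others are subsets of a
  -- smaller set, handled by induction. It turns a product over possible components into one over
  -- vertices when nothing is contracted.
  fold-singletons : ∀ {k} {f : Subset k → Carrier} →
    (∀ C → (∀ v → C ≢ ⁅ v ⁆) → f C ∼ ι) → fold (allBoolVecs k) f ∼ fold (allFin k) (λ v → f ⁅ v ⁆)
  fold-singletons {zero}  trivial = trans (identityʳ _) (trivial [] λ ())
  fold-singletons {suc k} {f} trivial = begin
    fold (allBoolVecs (suc k)) f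
      ≈⟨ fold-allBoolVecs k ⟩
    fold (allBoolVecs k) (λ C → f (true ∷ C)) ∙ fold (allBoolVecs k) (λ C → f (false ∷ C))
      ≈⟨ ∙-cong
           (fold-single (allBoolVecs-unique k) (allBoolVecs-complete ⊥) λ C C≢⊥ →
             trivial (true ∷ C) λ { zero ≡.refl → C≢⊥ ≡.refl ; (suc v) () })
           (fold-singletons λ C C≢ →
             trivial (false ∷ C) λ { zero () ; (suc v) ≡.refl → C≢ v ≡.refl }) ⟩
    f ⁅ zero ⁆ ∙ fold (allFin k) (λ v → f ⁅ suc v ⁆)
      ≈⟨ ∙-congˡ (fold-map suc (allFin k)) ⟨
    f ⁅ zero ⁆ ∙ fold (map suc (allFin k)) (λ v → f ⁅ v ⁆)
      ≡⟨ cong (λ l → f ⁅ zero ⁆ ∙ fold l (λ v → f ⁅ v ⁆)) (map-tabulate id suc) ⟩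
    fold (allFin (suc k)) (λ v → f ⁅ v ⁆) ∎

  module _ (_≟_ : DecidableEquality X) where
    open import Data.List.Membership.DecPropositional _≟_ using () renaming (_∈?_ to _∈ₗ?_)

    infixl 6 _∖_
    -- Neutralising values in place allows several factors to be split off one after another from
    -- the same list.
    _∖_ : (X → Carrier) → List X → X → Carrier
    (f ∖ zs) x = if does (x ∈ₗ? zs) then ι else f x

    ∖-∉ : ∀ (f : X → Carrier) zs {x} → x ∉ₗ zs → (f ∖ zs) x ∼ f x
    ∖-∉ f zs {x} x∉ with x ∈ₗ? zs
    ... | yes x∈ = ⊥-elim (x∉ x∈)
    ... | no _   = refl

    ∖-∈ : ∀ (f : X → Carrier) zs {x} → x ∈ₗ zs → (f ∖ zs) x ∼ ι
    ∖-∈ f zs {x} x∈ with x ∈ₗ? zs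
    ... | yes _  = refl
    ... | no x∉ = ⊥-elim (x∉ x∈)

    ∖-cong : ∀ {f g : X → Carrier} {zs} → (∀ x → x ∉ₗ zs → f x ∼ g x) → ∀ x → (f ∖ zs) x ∼ (g ∖ zs) x
    ∖-cong {zs = zs} eq x with x ∈ₗ? zs
    ... | yes _ = refl
    ... | no x∉ = eq x x∉

    fold-∖ : ∀ {f : X → Carrier} {xs z zs} → Unique xs → z ∈ₗ xs → z ∉ₗ zs →
      fold xs (f ∖ zs) ∼ f z ∙ fold xs (f ∖ (z ∷ zs))
    fold-∖ {f} {xs} {z} {zs} u z∈ z∉ =
      trans (fold-extract {g = f ∖ (z ∷ zs)} u z∈ agree (∖-∈ f (z ∷ zs) (here ≡.refl))) (∙-congʳ (∖-∉ f zs z∉))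
      where
      agree : ∀ y → y ≢ z → (f ∖ zs) y ∼ (f ∖ (z ∷ zs)) y
      agree y y≢z = by-cases (y ∈ₗ? zs)
        where
        by-cases : Dec (y ∈ₗ zs) → (f ∖ zs) y ∼ (f ∖ (z ∷ zs)) y
        by-cases (yes y∈) = trans (∖-∈ f zs y∈) (sym (∖-∈ f (z ∷ zs) (there y∈)))
        by-cases (no y∉)  = trans (∖-∉ f zs y∉)
          (sym (∖-∉ f (z ∷ zs) λ { (here e) → y≢z e ; (there i) → y∉ i }))

-- Walks as reflexive transitive closures.

module _ {R : Fin m → Fin n → Fin n → Set} where

  walk⇒star : ∀ {u v} s → Walk R u s v → Star (λ a b → ∃ λ e → R e a b) u v
  walk⇒star []            ≡.refl  = ε
  walk⇒star ((e , w) ∷ s) (r , p) = (e , r) ◅ walk⇒star s p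

  star⇒walk : ∀ {u v} → Star (λ a b → ∃ λ e → R e a b) u v → ∃ λ s → Walk R u s v
  star⇒walk ε             = [] , ≡.refl
  star⇒walk ((e , r) ◅ p) with star⇒walk p
  ... | s , q = (e , _) ∷ s , r , q

-- The bounded search for walks applies once every step carries the same label, the only element of
-- `Fin 1`.
star? : {T : Fin n → Fin n → Set} → (∀ a b → Dec (T a b)) → ∀ u v → Dec (Star T u v)
star? {T = T} T? u v = map′
  (λ (s , p) → Star.map proj₂ (walk⇒star s p))
  (λ p → star⇒walk (Star.map (zero ,_) p))
  (anyWalk? {1} {R = λ _ → T} (λ _ → T?) u v)

-- Reachability and acyclicity with contracted and oriented edges.

Pairs : ℕ → Set
Pairs n = List (Fin n × Fin n)

-- Instead of forming quotients, a pair (K , A) stands for the graph in which the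
-- edges K are contracted, hence traversed both ways, and A are oriented edges.
Step : Pairs n → Pairs n → Fin n → Fin n → Set
Step K A a b = (a , b) ∈ₗ K ⊎ (b , a) ∈ₗ K ⊎ (a , b) ∈ₗ A

Reach : Pairs n → Pairs n → Fin n → Fin n → Set
Reach K A = Star (Step K A)

Conn : Pairs n → Fin n → Fin n → Set
Conn K = Reach K []

-- In the contracted graph this forbids directed cycles; an arc whose ends are joined by contracted
-- edges counts as a loop.
Acyc : Pairs n → Pairs n → Set
Acyc K A = All (λ (a , b) → ¬ Reach K A b a) A

Component : Pairs n → Subset n → Set
Component K C = Nonempty C × (∀ u → u ∈ C → ∀ w → w ∈ C ⇔ Conn K u w)

-- For a component `C` of an acyclic pair this is the sink condition in the contracted graph, since
-- an arc with both ends in `C` would be a loop.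
NoExit : Pairs n → Subset n → Set
NoExit A C = All (λ (a , _) → a ∉ C) A

abstract
  reach? : ∀ (K A : Pairs n) u v → Dec (Reach K A u v)
  reach? K A = star? λ a b → ((a , b) ∈ₗ? K) ⊎-dec ((b , a) ∈ₗ? K) ⊎-dec ((a , b) ∈ₗ? A)
    where open DecMembership (Product.≡-dec Fin._≟_ Fin._≟_) renaming (_∈?_ to _∈ₗ?_)

acyc? : ∀ (K A : Pairs n) → Dec (Acyc K A)
acyc? K A = All.all? (λ (a , b) → ¬? (reach? K A b a)) A

component? : ∀ (K : Pairs n) C → Dec (Component K C)
component? K C = nonempty? C ×-dec Fin.all? λ u → (u ∈? C) →-dec Fin.all? λ w → map′
  (λ (f , g) → mk⇔ f g) (λ eq → Equivalence.to eq , Equivalence.from eq)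
  (((w ∈? C) →-dec reach? K [] u w) ×-dec (reach? K [] u w →-dec (w ∈? C)))

noExit? : ∀ (A : Pairs n) C → Dec (NoExit A C)
noExit? A C = All.all? (λ (a , _) → ¬? (a ∈? C)) A

module _ {K A K′ A′ : Pairs n} (K⊆ : ∀ {x} → x ∈ₗ K → x ∈ₗ K′) (A⊆ : ∀ {x} → x ∈ₗ A → x ∈ₗ A′) where

  reach-mono : ∀ {a b} → Reach K A a b → Reach K′ A′ a b
  reach-mono = Star.map λ
    { (inj₁ i)        → inj₁ (K⊆ i)
    ; (inj₂ (inj₁ i)) → inj₂ (inj₁ (K⊆ i))
    ; (inj₂ (inj₂ i)) → inj₂ (inj₂ (A⊆ i)) }

  acyc-anti : Acyc K′ A′ → Acyc K A
  acyc-anti acyc = All.tabulate λ i r → All.lookup acyc (A⊆ i) (reach-mono r)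

conn⇒reach : ∀ {K A : Pairs n} {a b} → Conn K a b → Reach K A a b
conn⇒reach = reach-mono id λ ()

conn-sym : ∀ {K : Pairs n} {a b} → Conn K a b → Conn K b a
conn-sym = Star.reverse λ
  { (inj₁ i) → inj₂ (inj₁ i) ; (inj₂ (inj₁ i)) → inj₁ i ; (inj₂ (inj₂ ())) }

module _ {K A : Pairs n} where

  step-arc : ∀ {u v a b} → Step K ((u , v) ∷ A) a b → Step K A a b ⊎ (a ≡ u × b ≡ v)
  step-arc (inj₁ i)                     = inj₁ (inj₁ i)
  step-arc (inj₂ (inj₁ i))              = inj₁ (inj₂ (inj₁ i))
  step-arc (inj₂ (inj₂ (here ≡.refl)))  = inj₂ (≡.refl , ≡.refl)
  step-arc (inj₂ (inj₂ (there i)))      = inj₁ (inj₂ (inj₂ i))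

  -- The path is cut before the first and after the last use of the new arc, and the part in between
  -- is dropped.
  reach-arc : ∀ {u v a b} → Reach K ((u , v) ∷ A) a b →
    Reach K A a b ⊎ (Reach K A a u × Reach K A v b)
  reach-arc ε = inj₁ ε
  reach-arc (s ◅ r) with step-arc s | reach-arc r
  ... | inj₁ t                 | inj₁ q       = inj₁ (t ◅ q)
  ... | inj₁ t                 | inj₂ (p , q) = inj₂ (t ◅ p , q)
  ... | inj₂ (≡.refl , ≡.refl) | inj₁ q       = inj₂ (ε , q)
  ... | inj₂ (≡.refl , ≡.refl) | inj₂ (_ , q) = inj₂ (ε , q)

  step-edge : ∀ {u v a b} → Step ((u , v) ∷ K) A a b →
    Step K A a b ⊎ (a ≡ u × b ≡ v) ⊎ (a ≡ v × b ≡ u)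
  step-edge (inj₁ (here ≡.refl))         = inj₂ (inj₁ (≡.refl , ≡.refl))
  step-edge (inj₁ (there i))             = inj₁ (inj₁ i)
  step-edge (inj₂ (inj₁ (here ≡.refl)))  = inj₂ (inj₂ (≡.refl , ≡.refl))
  step-edge (inj₂ (inj₁ (there i)))      = inj₁ (inj₂ (inj₁ i))
  step-edge (inj₂ (inj₂ i))              = inj₁ (inj₂ (inj₂ i))

  -- As for an arc, but the edge may be used both ways. If its first use departs from the vertex at
  -- which its last use arrives, dropping everything in between avoids the edge altogether.
  reach-edge : ∀ {u v a b} → Reach ((u , v) ∷ K) A a b →
    Reach K A a b ⊎ (Reach K A a u × Reach K A v b) ⊎ (Reach K A a v × Reach K A u b)
  reach-edge ε = inj₁ ε
  reach-edge (s ◅ r) with step-edge s | reach-edge r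
  ... | inj₁ t                        | inj₁ q              = inj₁ (t ◅ q)
  ... | inj₁ t                        | inj₂ (inj₁ (p , q)) = inj₂ (inj₁ (t ◅ p , q))
  ... | inj₁ t                        | inj₂ (inj₂ (p , q)) = inj₂ (inj₂ (t ◅ p , q))
  ... | inj₂ (inj₁ (≡.refl , ≡.refl)) | inj₁ q              = inj₂ (inj₁ (ε , q))
  ... | inj₂ (inj₁ (≡.refl , ≡.refl)) | inj₂ (inj₁ (_ , q)) = inj₂ (inj₁ (ε , q))
  ... | inj₂ (inj₁ (≡.refl , ≡.refl)) | inj₂ (inj₂ (_ , q)) = inj₁ q
  ... | inj₂ (inj₂ (≡.refl , ≡.refl)) | inj₁ q              = inj₂ (inj₂ (ε , q))
  ... | inj₂ (inj₂ (≡.refl , ≡.refl)) | inj₂ (inj₁ (_ , q)) = inj₁ q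
  ... | inj₂ (inj₂ (≡.refl , ≡.refl)) | inj₂ (inj₂ (_ , q)) = inj₂ (inj₂ (ε , q))

  -- The path is followed up to its first directed arc. Whenever that arc can be closed up to a
  -- cycle, acyclicity leaves only the first alternative.
  first-arc : ∀ {a b} → Reach K A a b →
    Conn K a b ⊎ ∃₂ λ c d → (c , d) ∈ₗ A × Conn K a c × Reach K A d b
  first-arc ε = inj₁ ε
  first-arc (inj₂ (inj₂ i) ◅ r) = inj₂ (_ , _ , i , ε , r)
  first-arc (inj₁ i ◅ r) with first-arc r
  ... | inj₁ q                   = inj₁ (inj₁ i ◅ q)
  ... | inj₂ (c , d , j , p , q) = inj₂ (c , d , j , inj₁ i ◅ p , q)
  first-arc (inj₂ (inj₁ i) ◅ r) with first-arc r
  ... | inj₁ q                   = inj₁ (inj₂ (inj₁ i) ◅ q)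
  ... | inj₂ (c , d , j , p , q) = inj₂ (c , d , j , inj₂ (inj₁ i) ◅ p , q)

  -- A cycle through an old arc that also uses the new one contains a path from `v` to the tail of
  -- the old arc and one from its head to `u`; the old arc links them to a path from `v` to `u`.
  acyc-arc⁺ : ∀ {u v} → Acyc K A → ¬ Reach K A v u → Acyc K ((u , v) ∷ A)
  acyc-arc⁺ {u} {v} acyc ¬vu = (λ r → [ ¬vu , ¬vu ∘ proj₁ ]′ (reach-arc r)) ∷ All.tabulate old
    where
    old : ∀ {x} → x ∈ₗ A → ¬ Reach K ((u , v) ∷ A) (proj₂ x) (proj₁ x)
    old i r with reach-arc r
    ... | inj₁ q       = All.lookup acyc i q
    ... | inj₂ (p , q) = ¬vu (q ◅◅ (inj₂ (inj₂ i) ◅ p))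

  acyc-arc⁻ : ∀ {u v} → Acyc K ((u , v) ∷ A) → ¬ Reach K A v u
  acyc-arc⁻ (¬vu ∷ _) r = ¬vu (reach-mono id there r)

  acyc-edge⁺ : ∀ {u v} → Acyc K A → ¬ Reach K A u v → ¬ Reach K A v u → Acyc ((u , v) ∷ K) A
  acyc-edge⁺ {u} {v} acyc ¬uv ¬vu = All.tabulate old
    where
    old : ∀ {x} → x ∈ₗ A → ¬ Reach ((u , v) ∷ K) A (proj₂ x) (proj₁ x)
    old i r with reach-edge r
    ... | inj₁ q              = All.lookup acyc i q
    ... | inj₂ (inj₁ (p , q)) = ¬vu (q ◅◅ (inj₂ (inj₂ i) ◅ p))
    ... | inj₂ (inj₂ (p , q)) = ¬uv (q ◅◅ (inj₂ (inj₂ i) ◅ p))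

  -- A path from u to v that leaves the component of u uses an arc, and joining v
  -- back to u closes a cycle through that arc.
  acyc-merged⁻ : ∀ {K′ u v} → (∀ {x} → x ∈ₗ K → x ∈ₗ K′) → Conn K′ v u → Acyc K′ A →
    Reach K A u v → Conn K u v
  acyc-merged⁻ K⊆ vu acyc r with first-arc r
  ... | inj₁ q                   = q
  ... | inj₂ (c , d , i , p , q) = ⊥-elim (All.lookup acyc i
    (reach-mono K⊆ id q ◅◅ conn⇒reach vu ◅◅ reach-mono K⊆ (λ ()) p))

  -- An arc on the path from `u` to `v` would be closed to a directed cycle by the path from `v`
  -- back to `u`.
  acyc-antisym : ∀ {u v} → Acyc K A → Reach K A u v → Reach K A v u → Conn K u v
  acyc-antisym acyc uv vu with first-arc uv
  ... | inj₁ q                   = q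
  ... | inj₂ (c , d , i , p , q) = ⊥-elim (All.lookup acyc i (q ◅◅ vu ◅◅ conn⇒reach p))

  -- A path that starts in `C` and leaves it needs an arc, and its first arc has its tail still in
  -- `C`.
  noExit⇒∉ : ∀ {u v C} → Component K C → NoExit A C → Reach K A u v → ¬ Conn K u v → u ∉ C
  noExit⇒∉ (_ , closed) exit uv ¬uv u∈ with first-arc uv
  ... | inj₁ q                   = ¬uv q
  ... | inj₂ (c , d , i , p , _) = All.lookup exit i (Equivalence.from (closed _ u∈ c) p)

-- Components, and how contracting an edge changes them.

module _ (K : Pairs n) where

  component : Fin n → Subset n
  component u = Vec.tabulate λ w → does (reach? K [] u w)

  ∈-component⁺ : ∀ {u w} → Conn K u w → w ∈ component u
  ∈-component⁺ {u} {w} p = Vec.lookup⇒[]= w _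
    (≡.trans (Vec.lookup∘tabulate _ w) (dec-true (reach? K [] u w) p))

  ∈-component⁻ : ∀ {u w} → w ∈ component u → Conn K u w
  ∈-component⁻ {u} {w} i = invert (≡.subst (Reflects _)
    (≡.trans (≡.sym (Vec.lookup∘tabulate _ w)) (Vec.[]=⇒lookup i)) (Dec.proof (reach? K [] u w)))

  component-isComponent : ∀ u → Component K (component u)
  component-isComponent u = (u , ∈-component⁺ ε) , λ a a∈ w → mk⇔
    (λ w∈ → conn-sym (∈-component⁻ a∈) ◅◅ ∈-component⁻ w∈)
    (λ p → ∈-component⁺ (∈-component⁻ a∈ ◅◅ p))

  component-unique : ∀ {u C} → Component K C → u ∈ C → C ≡ component u
  component-unique (_ , closed) u∈ = ⊆-antisym
    (λ w∈ → ∈-component⁺ (Equivalence.to (closed _ u∈ _) w∈))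
    (λ w∈ → Equivalence.from (closed _ u∈ _) (∈-component⁻ w∈))

module _ {K : Pairs n} {u v : Fin n} (¬uv : ¬ Conn K u v) where

  private
    Cᵤ = component K u
    Cᵥ = component K v

  v∉Cᵤ : v ∉ Cᵤ
  v∉Cᵤ = ¬uv ∘ ∈-component⁻ K

  u∉Cᵥ : u ∉ Cᵥ
  u∉Cᵥ = ¬uv ∘ conn-sym ∘ ∈-component⁻ K

  u∈Cᵤ : u ∈ Cᵤ
  u∈Cᵤ = ∈-component⁺ K ε

  v∈Cᵥ : v ∈ Cᵥ
  v∈Cᵥ = ∈-component⁺ K ε

  disjoint : ∀ {x} → x ∈ Cᵤ → x ∉ Cᵥ
  disjoint x∈ x∈′ = ¬uv (∈-component⁻ K x∈ ◅◅ conn-sym (∈-component⁻ K x∈′))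

  ∪-¬component : ¬ Component K (Cᵤ ∪ Cᵥ)
  ∪-¬component (_ , closed) = ¬uv (Equivalence.to
    (closed u (x∈p∪q⁺ (inj₁ u∈Cᵤ)) v) (x∈p∪q⁺ (inj₂ v∈Cᵥ)))

  merged-uv : Conn ((u , v) ∷ K) u v
  merged-uv = inj₁ (here ≡.refl) ◅ ε

  ∪-component : Component ((u , v) ∷ K) (Cᵤ ∪ Cᵥ)
  ∪-component = (u , x∈p∪q⁺ (inj₁ u∈Cᵤ)) , λ a a∈ w → mk⇔
    (λ w∈ → conn-sym (from-u a∈) ◅◅ from-u w∈)
    (λ p → into (from-u a∈ ◅◅ p))
    where
    from-u : ∀ {x} → x ∈ Cᵤ ∪ Cᵥ → Conn ((u , v) ∷ K) u x
    from-u x∈ with x∈p∪q⁻ Cᵤ Cᵥ x∈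
    ... | inj₁ i = reach-mono there id (∈-component⁻ K i)
    ... | inj₂ i = merged-uv ◅◅ reach-mono there id (∈-component⁻ K i)

    into : ∀ {x} → Conn ((u , v) ∷ K) u x → x ∈ Cᵤ ∪ Cᵥ
    into p with reach-edge p
    ... | inj₁ q              = x∈p∪q⁺ (inj₁ (∈-component⁺ K q))
    ... | inj₂ (inj₁ (_ , q)) = x∈p∪q⁺ (inj₂ (∈-component⁺ K q))
    ... | inj₂ (inj₂ (_ , q)) = x∈p∪q⁺ (inj₁ (∈-component⁺ K q))

  ∌v⇒¬component : ∀ {C} → u ∈ C → v ∉ C → ¬ Component ((u , v) ∷ K) C
  ∌v⇒¬component u∈ v∉ (_ , closed) = v∉ (Equivalence.from (closed u u∈ v) merged-uv)

  ∌u⇒¬component : ∀ {C} → v ∈ C → u ∉ C → ¬ Component ((u , v) ∷ K) C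
  ∌u⇒¬component v∈ u∉ (_ , closed) = u∉ (Equivalence.from (closed v v∈ u) (conn-sym merged-uv))

  -- Contraction changes connectivity only along paths that visit `u` or `v`, and a component
  -- containing one of them, before or after, is one of the three excluded sets.
  component-edge : ∀ {C} → C ≢ Cᵤ → C ≢ Cᵥ → C ≢ Cᵤ ∪ Cᵥ → Component ((u , v) ∷ K) C ⇔ Component K C
  component-edge {C} ≢u ≢v ≢uv = mk⇔ to from
    where
    from : Component K C → Component ((u , v) ∷ K) C
    from comp@(ne , closed) = ne , λ a a∈ w → mk⇔
      (λ w∈ → reach-mono there id (Equivalence.to (closed a a∈ w) w∈))
      (λ p → back a∈ (reach-edge p))
      where
      back : ∀ {a w} → a ∈ C →
        Conn K a w ⊎ (Conn K a u × Conn K v w) ⊎ (Conn K a v × Conn K u w) → w ∈ C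
      back a∈ (inj₁ p) = Equivalence.from (closed _ a∈ _) p
      back a∈ (inj₂ (inj₁ (p , _))) =
        ⊥-elim (≢u (component-unique K comp (Equivalence.from (closed _ a∈ _) p)))
      back a∈ (inj₂ (inj₂ (p , _))) =
        ⊥-elim (≢v (component-unique K comp (Equivalence.from (closed _ a∈ _) p)))

    to : Component ((u , v) ∷ K) C → Component K C
    to comp@(ne , closed) = ne , λ a a∈ w → mk⇔
      (λ w∈ → back a∈ (reach-edge (Equivalence.to (closed a a∈ w) w∈)))
      (λ p → Equivalence.from (closed a a∈ w) (reach-mono there id p))
      where
      u∉ : u ∉ C
      u∉ u∈ = ≢uv (≡.trans (component-unique _ comp u∈)
        (≡.sym (component-unique _ ∪-component (x∈p∪q⁺ (inj₁ u∈Cᵤ)))))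

      v∉ : v ∉ C
      v∉ v∈ = u∉ (Equivalence.from (closed v v∈ u) (conn-sym merged-uv))

      back : ∀ {a w} → a ∈ C →
        Conn K a w ⊎ (Conn K a u × Conn K v w) ⊎ (Conn K a v × Conn K u w) → Conn K a w
      back a∈ (inj₁ p) = p
      back a∈ (inj₂ (inj₁ (p , _))) =
        ⊥-elim (u∉ (Equivalence.from (closed _ a∈ u) (reach-mono there id p)))
      back a∈ (inj₂ (inj₂ (p , _))) =
        ⊥-elim (v∉ (Equivalence.from (closed _ a∈ v) (reach-mono there id p)))

-- Orientations and contracted sets as lists of pairs.

arcs : (Fin m → Fin n × Fin n) → Vec Bool m → Pairs n → Pairs n
arcs es []      A = A
-- The smallest edge enters the accumulator first, so that the induction in `expansion` can hold it
-- as an arc while the larger edges are expanded.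
arcs es (b ∷ o) A = arcs (es ∘ suc) o ((if b then es zero else swap (es zero)) ∷ A)

chosen : (Fin m → Fin n × Fin n) → Vec Bool m → Pairs n
chosen es []          = []
chosen es (true  ∷ S) = es zero ∷ chosen (es ∘ suc) S
chosen es (false ∷ S) = chosen (es ∘ suc) S

Joined : Pairs n → Fin n × Fin n → Set
Joined K (u , v) = Conn K u v

-- Deciding the edges from the largest down, S never contracts or deletes an edge
-- that the earlier contractions have turned into a loop.
NoLoops : (Fin m → Fin n × Fin n) → Vec Bool m → Set
NoLoops es []      = ⊤
NoLoops es (b ∷ S) = NoLoops (es ∘ suc) S × ¬ Joined (chosen (es ∘ suc) S) (es zero)

noLoops? : ∀ (es : Fin m → Fin n × Fin n) S → Dec (NoLoops es S)
noLoops? es []      = yes tt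
noLoops? es (b ∷ S) = noLoops? (es ∘ suc) S ×-dec ¬? (reach? (chosen (es ∘ suc) S) [] _ _)

-- Deletion-contraction for weighted acyclic orientations.

module DeletionContraction (R : CommutativeRing 0ℓ 0ℓ)
  (w : Subset n → CommutativeRing.Carrier R)
  (w-∪ : ∀ C D → (∀ {x} → x ∈ C → x ∉ D) → CommutativeRing._≈_ R
    (CommutativeRing._+_ R (w (C ∪ D)) (CommutativeRing._*_ R (w C) (w D)))
    (CommutativeRing._+_ R (w C) (w D)))
  where
  open CommutativeRing R hiding (zero) renaming (_≈_ to _∼_)
  open SetoidReasoning setoid
  open Fold *-commutativeMonoid using (fold-cong; fold-∖; ∖-cong; _∖_) renaming (fold to product)
  open Fold +-commutativeMonoid using (fold-allBoolVecs)
    renaming (fold to sum; fold-cong to sum-cong; fold-∙ to sum-+)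

  abstract
    factor : Pairs n → Pairs n → Subset n → Carrier
    factor K A C = if does (component? K C ×-dec noExit? A C) then w C else 1#

    factor-sink : ∀ {K A C} → Component K C → NoExit A C → factor K A C ∼ w C
    factor-sink {K} {A} {C} comp exit = reflexive (if-yes (component? K C ×-dec noExit? A C) (comp , exit))

    factor-¬component : ∀ {K A C} → ¬ Component K C → factor K A C ∼ 1#
    factor-¬component {K} {A} {C} ¬comp = reflexive (if-no (component? K C ×-dec noExit? A C) (¬comp ∘ proj₁))

    factor-exit : ∀ {K A C} → ¬ NoExit A C → factor K A C ∼ 1#
    factor-exit {K} {A} {C} ¬exit = reflexive (if-no (component? K C ×-dec noExit? A C) (¬exit ∘ proj₂))

    factor-cong : ∀ {K A K′ A′ C} → (Component K C × NoExit A C) ⇔ (Component K′ C × NoExit A′ C) →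
      factor K A C ∼ factor K′ A′ C
    factor-cong {K} {A} {K′} {A′} {C} eq = reflexive (cong (if_then w C else 1#)
      (does-⇔ eq (component? K C ×-dec noExit? A C) (component? K′ C ×-dec noExit? A′ C)))

  -- The product runs over all subsets, with factor one for those that are not sink components, so
  -- products for different contractions can be compared over one list.
  sinkWeight : Pairs n → Pairs n → Carrier
  sinkWeight K A = product (allBoolVecs n) (factor K A)

  weight : Pairs n → Pairs n → Carrier
  weight K A = if does (acyc? K A) then sinkWeight K A else 0#

  weight-acyc : ∀ {K A} → Acyc K A → weight K A ∼ sinkWeight K A
  weight-acyc {K} {A} acyc =
    reflexive (if-yes (acyc? K A) acyc)

  weight-¬acyc : ∀ {K A} → ¬ Acyc K A → weight K A ∼ 0#
  weight-¬acyc {K} {A} ¬acyc =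
    reflexive (if-no (acyc? K A) ¬acyc)

  factor-arc : ∀ {K A C u v} → C ≢ component K u → factor K ((u , v) ∷ A) C ∼ factor K A C
  factor-arc {K} ≢u = sym (factor-cong (mk⇔
    (λ (comp , exit) → comp , (λ u∈ → ≢u (component-unique K comp u∈)) ∷ exit)
    (λ { (comp , _ ∷ exit) → comp , exit })))

  -- Since `u` already reaches a vertex outside its component, that component has an exit, and the
  -- new arc destroys no sink.
  sinkWeight-arc : ∀ {K A u v} → Reach K A u v → ¬ Conn K u v →
    sinkWeight K ((u , v) ∷ A) ∼ sinkWeight K A
  sinkWeight-arc uv ¬uv = fold-cong (allBoolVecs n) λ C → factor-cong (mk⇔
    (λ { (comp , _ ∷ exit) → comp , exit })
    (λ (comp , exit) → comp , noExit⇒∉ comp exit uv ¬uv ∷ exit))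

  _≟ₛ_ : DecidableEquality (Subset n)
  _≟ₛ_ = Vec.≡-dec Bool._≟_

  module Unreachable {K A : Pairs n} {u v : Fin n} (¬uv : ¬ Conn K u v) where

    private
      Cᵤ = component K u
      Cᵥ = component K v
      Cᵤᵥ = Cᵤ ∪ Cᵥ
      α = factor K A Cᵤ
      β = factor K A Cᵥ
      γ = factor ((u , v) ∷ K) A Cᵤᵥ

    Cᵤ≢Cᵥ : Cᵤ ≢ Cᵥ
    Cᵤ≢Cᵥ eq = u∉Cᵥ ¬uv (≡.subst (u ∈_) eq (u∈Cᵤ ¬uv))

    ∪≢Cᵤ : Cᵤᵥ ≢ Cᵤ
    ∪≢Cᵤ eq = v∉Cᵤ ¬uv (≡.subst (v ∈_) eq (x∈p∪q⁺ (inj₂ (v∈Cᵥ ¬uv))))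

    ∪≢Cᵥ : Cᵤᵥ ≢ Cᵥ
    ∪≢Cᵥ eq = u∉Cᵥ ¬uv (≡.subst (u ∈_) eq (x∈p∪q⁺ (inj₁ (u∈Cᵤ ¬uv))))

    special : List (Subset n)
    special = Cᵤᵥ ∷ Cᵥ ∷ Cᵤ ∷ []

    rest : Carrier
    rest = product (allBoolVecs n) ((_∖_ _≟ₛ_) (factor K A) special)

    -- Both orientations, the contraction and the deletion differ at most in the factors of the
    -- components of `u` and `v` and of their union; `rest` is common to all four.
    sinkWeight-split : ∀ {K′ A′ a b c} → (∀ C → C ∉ₗ special → factor K′ A′ C ∼ factor K A C) →
      factor K′ A′ Cᵤ ∼ a → factor K′ A′ Cᵥ ∼ b → factor K′ A′ Cᵤᵥ ∼ c →
      sinkWeight K′ A′ ∼ (a * (b * c)) * rest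
    sinkWeight-split {K′} {A′} {a} {b} {c} agree fᵤ fᵥ fᵤᵥ = begin
      product all f
        ≈⟨ fold-∖ _≟ₛ_ {f} {zs = []} unique (allBoolVecs-complete Cᵤ) (λ ()) ⟩
      f Cᵤ * product all (f ∖′ (Cᵤ ∷ []))
        ≈⟨ *-congˡ (fold-∖ _≟ₛ_ {f} {zs = Cᵤ ∷ []} unique (allBoolVecs-complete Cᵥ)
             λ { (here e) → Cᵤ≢Cᵥ (≡.sym e) }) ⟩
      f Cᵤ * (f Cᵥ * product all (f ∖′ (Cᵥ ∷ Cᵤ ∷ [])))
        ≈⟨ *-congˡ (*-congˡ (fold-∖ _≟ₛ_ {f} {zs = Cᵥ ∷ Cᵤ ∷ []} unique (allBoolVecs-complete Cᵤᵥ)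
             λ { (here e) → ∪≢Cᵥ e ; (there (here e)) → ∪≢Cᵤ e })) ⟩
      f Cᵤ * (f Cᵥ * (f Cᵤᵥ * product all (f ∖′ special)))
        ≈⟨ *-cong fᵤ (*-cong fᵥ (*-cong fᵤᵥ (fold-cong all (∖-cong _≟ₛ_ {f} {factor K A} {special} agree)))) ⟩
      a * (b * (c * rest))   ≈⟨ *-congˡ (*-assoc _ _ _) ⟨
      a * ((b * c) * rest)   ≈⟨ *-assoc _ _ _ ⟨
      (a * (b * c)) * rest   ∎
      where
      all = allBoolVecs n
      unique = allBoolVecs-unique n
      f = factor K′ A′

      infixl 6 _∖′_
      _∖′_ : (Subset n → Carrier) → List (Subset n) → Subset n → Carrier
      _∖′_ = _∖_ _≟ₛ_

    sinkWeight-deleted : sinkWeight K A ∼ (α * β) * rest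
    sinkWeight-deleted = trans
      (sinkWeight-split (λ _ _ → refl) refl refl (factor-¬component (∪-¬component ¬uv)))
      (*-congʳ (*-congˡ (*-identityʳ β)))

    sinkWeight-uv : sinkWeight K ((u , v) ∷ A) ∼ β * rest
    sinkWeight-uv = trans
      (sinkWeight-split (λ C C∉ → factor-arc λ e → C∉ (there (there (here e))))
        -- The new arc leaves the component of `u`, which is therefore not a sink; the component of
        -- `v` keeps its factor.
        (factor-exit λ { (u∉ ∷ _) → u∉ (u∈Cᵤ ¬uv) })
        (factor-arc λ e → Cᵤ≢Cᵥ (≡.sym e))
        (factor-¬component (∪-¬component ¬uv)))
      (*-congʳ (trans (*-identityˡ _) (*-identityʳ β)))

    sinkWeight-vu : sinkWeight K ((v , u) ∷ A) ∼ α * rest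
    sinkWeight-vu = trans
      (sinkWeight-split (λ C C∉ → factor-arc λ e → C∉ (there (here e)))
        (factor-arc Cᵤ≢Cᵥ)
        (factor-exit λ { (v∉ ∷ _) → v∉ (v∈Cᵥ ¬uv) })
        (factor-¬component (∪-¬component ¬uv)))
      (*-congʳ (trans (*-congˡ (*-identityʳ 1#)) (*-identityʳ α)))

    sinkWeight-contracted : sinkWeight ((u , v) ∷ K) A ∼ γ * rest
    sinkWeight-contracted = trans
      (sinkWeight-split
        (λ C C∉ → factor-cong (×-⇔ (component-edge ¬uv
          (λ e → C∉ (there (there (here e)))) (λ e → C∉ (there (here e))) (λ e → C∉ (here e)))))
        (factor-¬component (∌v⇒¬component ¬uv (u∈Cᵤ ¬uv) (v∉Cᵤ ¬uv)))
        (factor-¬component (∌u⇒¬component ¬uv (v∈Cᵥ ¬uv) (u∉Cᵥ ¬uv)))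
        refl)
      (*-congʳ (trans (*-identityˡ _) (*-identityˡ γ)))
      where
      ×-⇔ : ∀ {P Q T : Set} → P ⇔ Q → (P × T) ⇔ (Q × T)
      ×-⇔ e = mk⇔ (λ (p , t) → Equivalence.to e p , t) (λ (q , t) → Equivalence.from e q , t)

    -- Only the factors of the components of u and v change; the identity is
    -- nontrivial when both are sinks, where it is the hypothesis on w.
    factor-∪ : β + α ∼ γ + α * β
    factor-∪ = by-exits (noExit? A Cᵤ) (noExit? A Cᵥ)
      where
      by-exits : Dec (NoExit A Cᵤ) → Dec (NoExit A Cᵥ) → β + α ∼ γ + α * β
      by-exits (yes eᵤ) (yes eᵥ) = begin
        β + α                ≈⟨ +-cong b a ⟩
        w Cᵥ + w Cᵤ          ≈⟨ +-comm _ _ ⟩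
        w Cᵤ + w Cᵥ          ≈⟨ w-∪ Cᵤ Cᵥ (disjoint ¬uv) ⟨
        w Cᵤᵥ + w Cᵤ * w Cᵥ ≈⟨ +-cong c (*-cong a b) ⟨
        γ + α * β            ∎
        where
        a = factor-sink (component-isComponent K u) eᵤ
        b = factor-sink (component-isComponent K v) eᵥ
        c = factor-sink (∪-component ¬uv)
          (All.zipWith (λ (∉u , ∉v) i → [ ∉u , ∉v ]′ (x∈p∪q⁻ Cᵤ Cᵥ i)) (eᵤ , eᵥ))
      -- An exit from the component of `u` is also one from the union, so `α` and `γ` are both one.
      by-exits (no ¬eᵤ) _ = begin
        β + α      ≈⟨ +-congˡ a ⟩
        β + 1#     ≈⟨ +-comm _ _ ⟩
        1# + β     ≈⟨ +-cong c (*-identityˡ β) ⟨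
        γ + 1# * β ≈⟨ +-congˡ (*-congʳ a) ⟨
        γ + α * β  ∎
        where
        a = factor-exit {K} ¬eᵤ
        c = factor-exit {(u , v) ∷ K} (¬eᵤ ∘ All.map (_∘ x∈p∪q⁺ ∘ inj₁))
      by-exits _ (no ¬eᵥ) = begin
        β + α      ≈⟨ +-congʳ b ⟩
        1# + α     ≈⟨ +-cong c (*-identityʳ α) ⟨
        γ + α * 1# ≈⟨ +-congˡ (*-congˡ b) ⟨
        γ + α * β  ∎
        where
        b = factor-exit {K} ¬eᵥ
        c = factor-exit {(u , v) ∷ K} (¬eᵥ ∘ All.map (_∘ x∈p∪q⁺ ∘ inj₂))

    weight-unreachable : Acyc K A → ¬ Reach K A u v → ¬ Reach K A v u →
      weight K ((u , v) ∷ A) + weight K ((v , u) ∷ A) ∼ weight ((u , v) ∷ K) A + weight K A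
    weight-unreachable acyc ¬u⇝v ¬v⇝u = begin
      weight K ((u , v) ∷ A) + weight K ((v , u) ∷ A)
        ≈⟨ +-cong (trans (weight-acyc (acyc-arc⁺ acyc ¬v⇝u)) sinkWeight-uv)
                  (trans (weight-acyc (acyc-arc⁺ acyc ¬u⇝v)) sinkWeight-vu) ⟩
      β * rest + α * rest       ≈⟨ distribʳ _ _ _ ⟨
      (β + α) * rest            ≈⟨ *-congʳ factor-∪ ⟩
      (γ + α * β) * rest        ≈⟨ distribʳ _ _ _ ⟩
      γ * rest + (α * β) * rest
        ≈⟨ +-cong (trans (weight-acyc (acyc-edge⁺ acyc ¬u⇝v ¬v⇝u)) sinkWeight-contracted)
                  (trans (weight-acyc acyc) sinkWeight-deleted) ⟨
      weight ((u , v) ∷ K) A + weight K A ∎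

  -- An arc along an existing path creates no cycle, while the opposite arc or a contraction closes
  -- that path to a cycle. `K′` is general because the lemma is also applied with `u` and `v`
  -- exchanged while the contracted pair keeps its order.
  weight-reachable : ∀ {K K′ A u v} → Acyc K A → ¬ Conn K u v → Reach K A u v →
    (∀ {x} → x ∈ₗ K → x ∈ₗ K′) → Conn K′ v u →
    weight K ((u , v) ∷ A) ∼ weight K A × weight K ((v , u) ∷ A) ∼ 0# × weight K′ A ∼ 0#
  weight-reachable acyc ¬uv u⇝v K⊆ vu =
    trans (weight-acyc (acyc-arc⁺ acyc λ v⇝u → ¬uv (acyc-antisym acyc u⇝v v⇝u)))
      (trans (sinkWeight-arc u⇝v ¬uv) (sym (weight-acyc acyc))) ,
    weight-¬acyc (λ acyc′ → acyc-arc⁻ acyc′ u⇝v) ,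
    weight-¬acyc (λ acyc′ → ¬uv (acyc-merged⁻ K⊆ vu acyc′ u⇝v))

  weight-deletion-contraction : ∀ K A {u v} → ¬ Conn K u v →
    weight K ((u , v) ∷ A) + weight K ((v , u) ∷ A) ∼ weight ((u , v) ∷ K) A + weight K A
  weight-deletion-contraction K A {u} {v} ¬uv =
    by-cases (acyc? K A) (reach? K A u v) (reach? K A v u)
    where
    ¬acyc⇒0 : ¬ Acyc K A → ∀ {K′ A′} →
      (∀ {x} → x ∈ₗ K → x ∈ₗ K′) → (∀ {x} → x ∈ₗ A → x ∈ₗ A′) → weight K′ A′ ∼ 0#
    ¬acyc⇒0 ¬acyc K⊆ A⊆ = weight-¬acyc (¬acyc ∘ acyc-anti K⊆ A⊆)

    by-cases : Dec (Acyc K A) → Dec (Reach K A u v) → Dec (Reach K A v u) →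
      weight K ((u , v) ∷ A) + weight K ((v , u) ∷ A) ∼ weight ((u , v) ∷ K) A + weight K A
    -- All four terms extend `K` and `A`, so an existing cycle persists in each and all of them
    -- vanish.
    by-cases (no ¬acyc) _ _ = +-cong
      (trans (¬acyc⇒0 ¬acyc id there) (sym (¬acyc⇒0 ¬acyc there id)))
      (trans (¬acyc⇒0 ¬acyc id there) (sym (¬acyc⇒0 ¬acyc id id)))
    by-cases (yes acyc) (yes u⇝v) _ =
      let (a , b , c) = weight-reachable acyc ¬uv u⇝v there (conn-sym (merged-uv ¬uv))
      in trans (+-cong a b) (trans (+-comm _ _) (+-congʳ (sym c)))
    by-cases (yes acyc) (no _) (yes v⇝u) =
      let (a , b , c) = weight-reachable acyc (¬uv ∘ conn-sym) v⇝u there (merged-uv ¬uv)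
      in +-cong (trans b (sym c)) a
    by-cases (yes acyc) (no ¬u⇝v) (no ¬v⇝u) =
      Unreachable.weight-unreachable ¬uv acyc ¬u⇝v ¬v⇝u

  weight-loop : ∀ K A {u v} → Conn K u v → weight K ((u , v) ∷ A) + weight K ((v , u) ∷ A) ∼ 0#
  weight-loop K A uv = trans
    (+-cong (weight-¬acyc λ acyc → acyc-arc⁻ acyc (conn⇒reach (conn-sym uv)))
            (weight-¬acyc λ acyc → acyc-arc⁻ acyc (conn⇒reach uv)))
    (+-identityˡ 0#)

  expansion : ∀ {m} (es : Fin m → Fin n × Fin n) A →
    sum (allBoolVecs m) (λ o → weight [] (arcs es o A)) ∼
    sum (allBoolVecs m) (λ S → if does (noLoops? es S) then weight (chosen es S) A else 0#)
  expansion {zero}  es A = refl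
  expansion {suc m} es A = begin
    sum (allBoolVecs (suc m)) (λ o → weight [] (arcs es o A))
      ≈⟨ fold-allBoolVecs m ⟩
    sum all (λ o → weight [] (arcs es (true ∷ o) A)) +
    sum all (λ o → weight [] (arcs es (false ∷ o) A))
      -- The larger edges are expanded first, separately for each orientation of the smallest edge.
      ≈⟨ +-cong (expansion es′ (e ∷ A)) (expansion es′ (swap e ∷ A)) ⟩
    sum all (λ S → if does (noLoops? es′ S) then weight (chosen es′ S) (e ∷ A) else 0#) +
    sum all (λ S → if does (noLoops? es′ S) then weight (chosen es′ S) (swap e ∷ A) else 0#)
      ≈⟨ sum-+ all ⟨
    sum all (λ S → (if does (noLoops? es′ S) then weight (chosen es′ S) (e ∷ A) else 0#) +
                   (if does (noLoops? es′ S) then weight (chosen es′ S) (swap e ∷ A) else 0#))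
      ≈⟨ sum-cong all step ⟩
    sum all (λ S → term (true ∷ S) + term (false ∷ S))
      ≈⟨ sum-+ all ⟩
    sum all (λ S → term (true ∷ S)) + sum all (λ S → term (false ∷ S))
      ≈⟨ fold-allBoolVecs m ⟨
    sum (allBoolVecs (suc m)) term ∎
    where
    all = allBoolVecs m
    es′ = es ∘ suc
    e = es zero

    term : Vec Bool (suc m) → Carrier
    term S = if does (noLoops? es S) then weight (chosen es S) A else 0#

    step : ∀ S →
      (if does (noLoops? es′ S) then weight (chosen es′ S) (e ∷ A) else 0#) +
      (if does (noLoops? es′ S) then weight (chosen es′ S) (swap e ∷ A) else 0#) ∼
      term (true ∷ S) + term (false ∷ S)
    -- If `S` already fails, all terms are zero. If `S` joins the ends of `e`, both orientations
    -- have weight zero and `NoLoops` rejects both choices for `e`. Otherwise the terms for `true`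
    -- and `false` are the contraction and the deletion of `e`.
    step S with noLoops? es′ S | reach? (chosen es′ S) [] (proj₁ e) (proj₂ e)
    ... | no _  | _     = refl
    ... | yes _ | yes p = trans (weight-loop (chosen es′ S) A p) (sym (+-identityˡ 0#))
    ... | yes _ | no ¬p = weight-deletion-contraction (chosen es′ S) A ¬p

-- Cutting walks and distinctness of their edges.

module _ {R : Fin m → Fin n → Fin n → Set} where

  walk-edge : ∀ {u v f} s → Walk R u s v → f ∈ₗ edges s →
    ∃₂ λ a b → R f a b × a ∈ₗ u ∷ vertices s × b ∈ₗ vertices s
  walk-edge ((e , w) ∷ s) (r , _) (here ≡.refl) = _ , w , r , here ≡.refl , here ≡.refl
  walk-edge ((e , w) ∷ s) (_ , p) (there i) =
    let (a , b , r , a∈ , b∈) = walk-edge s p i in a , b , r , there a∈ , there b∈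

  walk⇒star-∈ : ∀ {Q : Fin m → Set} {u v} s → (∀ {f} → f ∈ₗ edges s → Q f) → Walk R u s v →
    Star (λ a b → ∃ λ f → Q f × R f a b) u v
  walk⇒star-∈ []            q ≡.refl  = ε
  walk⇒star-∈ ((e , w) ∷ s) q (r , p) = (e , q (here ≡.refl) , r) ◅ walk⇒star-∈ s (q ∘ there) p

  -- This opens a cycle at its smallest edge: as the edges are distinct, `e` occurs in neither
  -- remaining piece.
  walk-split : ∀ {Q : Fin m → Set} {u v e} s → (∀ {f} → f ∈ₗ edges s → f ≢ e → Q f) →
    Walk R u s v → Unique (edges s) → e ∈ₗ edges s →
    ∃₂ λ a b → R e a b × Star (λ x y → ∃ λ f → Q f × R f x y) u a ×
                         Star (λ x y → ∃ λ f → Q f × R f x y) b v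
  walk-split ((e , w) ∷ s) q (r , p) (e∉ ∷ _) (here ≡.refl) =
    _ , w , r , ε , walk⇒star-∈ s (λ i → q (there i) (All.lookup e∉ i ∘ ≡.sym)) p
  walk-split ((f , w) ∷ s) q (r , p) (f∉ ∷ unique) (there i) =
    let (a , b , r′ , ua , bv) = walk-split s (q ∘ there) p unique i
    in a , b , r′ , (f , q (here ≡.refl) (All.lookup f∉ i) , r) ◅ ua , bv

  -- An edge determines its two ends, so using the first edge again would revisit `u`.
  path-edges-unique : (G : Graph n m) → (∀ {e a b} → R e a b → Joins G e a b) →
    ∀ {u v} s → Walk R u s v → Unique (u ∷ vertices s) → Unique (edges s)
  path-edges-unique G R⇒ []            _       _              = []
  path-edges-unique G R⇒ ((e , w) ∷ s) (r , p) (u∉ ∷ unique) =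
    All.tabulate fresh ∷ path-edges-unique G R⇒ s p unique
    where
    shared : ∀ {a b c d} → Joins G e a b → Joins G e c d → a ≡ c ⊎ a ≡ d
    shared (inj₁ i) (inj₁ j) = inj₁ (cong proj₁ (≡.trans (≡.sym i) j))
    shared (inj₁ i) (inj₂ j) = inj₂ (cong proj₁ (≡.trans (≡.sym i) j))
    shared (inj₂ i) (inj₁ j) = inj₂ (cong proj₂ (≡.trans (≡.sym i) j))
    shared (inj₂ i) (inj₂ j) = inj₁ (cong proj₂ (≡.trans (≡.sym i) j))

    fresh : ∀ {f} → f ∈ₗ edges s → e ≢ f
    fresh f∈ ≡.refl with walk-edge s p f∈
    ... | a , b , r′ , a∈ , b∈ with shared (R⇒ r) (R⇒ r′)
    ...   | inj₁ ≡.refl = All.lookup u∉ a∈ ≡.refl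
    ...   | inj₂ ≡.refl = All.lookup u∉ (there b∈) ≡.refl

walk-map : ∀ {R T : Fin m → Fin n → Fin n → Set} → (∀ {e a b} → R e a b → T e a b) →
  ∀ {u v} s → Walk R u s v → Walk T u s v
walk-map f []            p       = p
walk-map f ((e , w) ∷ s) (r , p) = f r , walk-map f s p

joins-sym : ∀ (G : Graph n m) {e a b} → Joins G e a b → Joins G e b a
joins-sym G (inj₁ i) = inj₂ i
joins-sym G (inj₂ i) = inj₁ i

-- Translation between lists of pairs and edges of the graph.

chosen-∈⁺ : ∀ (es : Fin m → Fin n × Fin n) {S e} → e ∈ S → es e ∈ₗ chosen es S
chosen-∈⁺ es {true  ∷ S} here      = here ≡.refl
chosen-∈⁺ es {true  ∷ S} (there i) = there (chosen-∈⁺ (es ∘ suc) i)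
chosen-∈⁺ es {false ∷ S} (there i) = chosen-∈⁺ (es ∘ suc) i

chosen-∈⁻ : ∀ (es : Fin m → Fin n × Fin n) S {x} → x ∈ₗ chosen es S → ∃ λ e → e ∈ S × es e ≡ x
chosen-∈⁻ es (true ∷ S) (here ≡.refl) = zero , here , ≡.refl
chosen-∈⁻ es (true ∷ S) (there i) =
  let (e , e∈ , eq) = chosen-∈⁻ (es ∘ suc) S i in suc e , there e∈ , eq
chosen-∈⁻ es (false ∷ S) i =
  let (e , e∈ , eq) = chosen-∈⁻ (es ∘ suc) S i in suc e , there e∈ , eq

arcs-∈⁺ : ∀ (es : Fin m → Fin n × Fin n) o {A x} →
  x ∈ₗ A ⊎ (∃ λ e → (if Vec.lookup o e then es e else swap (es e)) ≡ x) → x ∈ₗ arcs es o A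
arcs-∈⁺ es []      (inj₁ i)                = i
arcs-∈⁺ es (b ∷ o) (inj₁ i)                = arcs-∈⁺ (es ∘ suc) o (inj₁ (there i))
arcs-∈⁺ es (b ∷ o) (inj₂ (zero , ≡.refl)) = arcs-∈⁺ (es ∘ suc) o (inj₁ (here ≡.refl))
arcs-∈⁺ es (b ∷ o) (inj₂ (suc e , eq))    = arcs-∈⁺ (es ∘ suc) o (inj₂ (e , eq))

arcs-∈⁻ : ∀ (es : Fin m → Fin n × Fin n) o {A x} → x ∈ₗ arcs es o A →
  x ∈ₗ A ⊎ (∃ λ e → (if Vec.lookup o e then es e else swap (es e)) ≡ x)
arcs-∈⁻ es []      i = inj₁ i
arcs-∈⁻ es (b ∷ o) i with arcs-∈⁻ (es ∘ suc) o i
... | inj₁ (here eq)  = inj₂ (zero , ≡.sym eq)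
... | inj₁ (there j)  = inj₁ j
... | inj₂ (e , eq)   = inj₂ (suc e , eq)

module _ (G : Graph n m) where

  chosen-step⁺ : ∀ {S A e a b} → e ∈ S → Joins G e a b → Step (chosen (endpoints G) S) A a b
  chosen-step⁺ e∈ (inj₁ ≡.refl) = inj₁ (chosen-∈⁺ (endpoints G) e∈)
  chosen-step⁺ {S} e∈ (inj₂ eq) =
    inj₂ (inj₁ (≡.subst (_∈ₗ chosen (endpoints G) S) eq (chosen-∈⁺ (endpoints G) e∈)))

  chosen-step⁻ : ∀ {S a b} → Step (chosen (endpoints G) S) [] a b → ∃ λ e → e ∈ S × Joins G e a b
  chosen-step⁻ {S} (inj₁ i) =
    let (e , e∈ , eq) = chosen-∈⁻ (endpoints G) S i in e , e∈ , inj₁ eq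
  chosen-step⁻ {S} (inj₂ (inj₁ i)) =
    let (e , e∈ , eq) = chosen-∈⁻ (endpoints G) S i in e , e∈ , inj₂ eq
  chosen-step⁻ (inj₂ (inj₂ ()))

  connected⇒conn : ∀ {S u v} → Connected G S u v → Conn (chosen (endpoints G) S) u v
  connected⇒conn (s , p) = Star.map (λ (e , e∈ , j) → chosen-step⁺ e∈ j) (walk⇒star s p)

  conn⇒connected : ∀ {S u v} → Conn (chosen (endpoints G) S) u v → Connected G S u v
  conn⇒connected p = star⇒walk (Star.map chosen-step⁻ p)

  component⇔isComponent : ∀ {S C} → Component (chosen (endpoints G) S) C ⇔ IsComponent G S C
  component⇔isComponent = mk⇔
    (λ (ne , closed) → ne , λ u u∈ w → mk⇔
      (conn⇒connected ∘ Equivalence.to (closed u u∈ w)) (Equivalence.from (closed u u∈ w) ∘ connected⇒conn))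
    (λ (ne , closed) → ne , λ u u∈ w → mk⇔
      (connected⇒conn ∘ Equivalence.to (closed u u∈ w)) (Equivalence.from (closed u u∈ w) ∘ conn⇒connected))

-- Broken circuits and edges that become loops.

StepAbove : Graph n m → Subset m → Fin m → Fin n → Fin n → Set
StepAbove G S e a b = ∃ λ f → (e < f × f ∈ S) × Joins G f a b

-- This is the failure of `NoLoops` at the single edge `e`, stated without recursion on the edge set
-- so that it can be compared with cycles of `G`.
JoinedAbove : Graph n m → Subset m → Fin m → Set
JoinedAbove G S e = Star (StepAbove G S e) (proj₁ (endpoints G e)) (proj₂ (endpoints G e))

tail : Graph n (suc m) → Graph n m
tail G = record { endpoints = endpoints G ∘ suc }

stepAbove-suc : ∀ (G : Graph n (suc m)) {b S e x y} →
  StepAbove (tail G) S e x y → StepAbove G (b ∷ S) (suc e) x y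
stepAbove-suc G (f , (e<f , f∈) , j) = suc f , (s<s e<f , there f∈) , j

stepAbove-suc⁻ : ∀ (G : Graph n (suc m)) {b S e x y} →
  StepAbove G (b ∷ S) (suc e) x y → StepAbove (tail G) S e x y
stepAbove-suc⁻ G (suc f , (e<f , there f∈) , j) = f , (s<s⁻¹ e<f , f∈) , j

stepAbove-zero : ∀ (G : Graph n (suc m)) {b S x y} →
  Step (chosen (endpoints (tail G)) S) [] x y → StepAbove G (b ∷ S) zero x y
stepAbove-zero G s = let (f , f∈ , j) = chosen-step⁻ (tail G) s in suc f , (z<s , there f∈) , j

stepAbove-zero⁻ : ∀ (G : Graph n (suc m)) {b S x y} →
  StepAbove G (b ∷ S) zero x y → Step (chosen (endpoints (tail G)) S) [] x y
stepAbove-zero⁻ G (suc f , (_ , there f∈) , j) = chosen-step⁺ (tail G) f∈ j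

noLoops⇒¬joinedAbove : ∀ (G : Graph n m) S → NoLoops (endpoints G) S → ∀ e → ¬ JoinedAbove G S e
noLoops⇒¬joinedAbove G (b ∷ S) (_ , ¬loop) zero    p = ¬loop (Star.map (stepAbove-zero⁻ G) p)
noLoops⇒¬joinedAbove G (b ∷ S) (ok , _)    (suc e) p =
  noLoops⇒¬joinedAbove (tail G) S ok e (Star.map (stepAbove-suc⁻ G) p)

¬joinedAbove⇒noLoops : ∀ (G : Graph n m) S → (∀ e → ¬ JoinedAbove G S e) → NoLoops (endpoints G) S
¬joinedAbove⇒noLoops G []      _  = tt
¬joinedAbove⇒noLoops G (b ∷ S) ok =
  ¬joinedAbove⇒noLoops (tail G) S (λ e p → ok (suc e) (Star.map (stepAbove-suc G) p)) ,
  λ p → ok zero (Star.map (stepAbove-zero G) p)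

∈-⋃⁺ : ∀ {x : Fin m} {xs} → x ∈ₗ xs → x ∈ ⋃ (map ⁅_⁆ xs)
∈-⋃⁺ {x = x} (here ≡.refl) = x∈p∪q⁺ (inj₁ (x∈⁅x⁆ x))
∈-⋃⁺ (there i)             = x∈p∪q⁺ (inj₂ (∈-⋃⁺ i))

∈-⋃⁻ : ∀ {x : Fin m} xs → x ∈ ⋃ (map ⁅_⁆ xs) → x ∈ₗ xs
∈-⋃⁻ []       i = ⊥-elim (∉⊥ i)
∈-⋃⁻ (y ∷ xs) i with x∈p∪q⁻ ⁅ y ⁆ _ i
... | inj₁ j = here (x∈⁅y⁆⇒x≡y y j)
... | inj₂ j = there (∈-⋃⁻ xs j)

x∉p-x : ∀ (p : Subset m) x → x ∉ p Subset.- x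
x∉p-x (b ∷ p) (suc x) (there i) = x∉p-x p x i

module _ (G : Graph n m) (S : Subset m) where
  open Subset using (_-_)

  -- All edges of the cycle other than `e` are larger than `e` and lie in the broken circuit, hence
  -- in `S`.
  brokenCircuit⇒joinedAbove : ∀ {B} → IsBrokenCircuit G B → B ⊆ S → ∃ (JoinedAbove G S)
  brokenCircuit⇒joinedAbove (x , s , (_ , p , unique , _) , e , e∈ , e≤ , ≡.refl) B⊆S =
    -- The walk is closed at `x`, so the piece after `e` followed by the piece before it joins the
    -- two ends of `e`.
    let (a , b , j , xa , bx) = walk-split s above p unique e∈
    in e , orient j (bx ◅◅ xa)
    where
    above : ∀ {f} → f ∈ₗ edges s → f ≢ e → e < f × f ∈ S
    above f∈ f≢e =
      Fin.≤∧≢⇒< (All.lookup e≤ f∈) (f≢e ∘ ≡.sym) , B⊆S (x∈p∧x≢y⇒x∈p-y (∈-⋃⁺ f∈) f≢e)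

    orient : ∀ {a b} → Joins G e a b → Star (StepAbove G S e) b a → JoinedAbove G S e
    orient (inj₁ eq) q with endpoints G e | eq
    ... | _ | ≡.refl = Star.reverse (λ (f , r , j) → f , r , joins-sym G j) q
    orient (inj₂ eq) q with endpoints G e | eq
    ... | _ | ≡.refl = q

  -- The connection is shortened to a path, whose distinct vertices make its closure by `e` a cycle.
  -- If `e` is a loop, the path is empty and so is the broken circuit.
  joinedAbove⇒¬inBrokenCircuitComplex : ∀ e → JoinedAbove G S e → ¬ InBrokenCircuitComplex G S
  joinedAbove⇒¬inBrokenCircuitComplex e q inB =
    let (s , p , unique) = path in inB
      (⋃ (map ⁅_⁆ (e ∷ edges s)) - e)
      -- The cycle starts at the second endpoint of `e`, crosses `e` backwards, and returns along
      -- the path.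
      (_ , (e , proj₁ (endpoints G e)) ∷ s ,
        ( s≤s z≤n
        , (inj₂ ≡.refl , walk-map proj₂ s p)
        , All.tabulate (λ f∈ → Fin.<⇒≢ (proj₁ (above s p f∈))) ∷ path-edges-unique G proj₂ s p unique
        , unique) ,
        e , here ≡.refl , Fin.≤-refl ∷ All.tabulate (λ f∈ → ℕ.<⇒≤ (proj₁ (above s p f∈))) , ≡.refl)
      (λ f∈ → within s p f∈ (∈-⋃⁻ (e ∷ edges s) (p─q⊆p (⋃ (map ⁅_⁆ (e ∷ edges s))) ⁅ e ⁆ f∈)))
    where
    R : Fin m → Fin n → Fin n → Set
    R f a b = (e < f × f ∈ S) × Joins G f a b

    R? : ∀ f a b → Dec (R f a b)
    R? f a b = ((e Fin.<? f) ×-dec (f ∈? S)) ×-dec joins? G f a b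

    path : Path R? (proj₁ (endpoints G e)) (proj₂ (endpoints G e))
    path = let (s , p) = star⇒walk q in walk⇒path R? s p

    above : ∀ {u v} s → Walk R u s v → ∀ {f} → f ∈ₗ edges s → e < f × f ∈ S
    above s p f∈ = let (_ , _ , r , _) = walk-edge s p f∈ in proj₁ r

    within : ∀ {u v} s → Walk R u s v → ∀ {f} → f ∈ ⋃ (map ⁅_⁆ (e ∷ edges s)) - e →
      f ∈ₗ e ∷ edges s → f ∈ S
    within s p f∈B (here ≡.refl) = ⊥-elim (x∉p-x _ e f∈B)
    within s p f∈B (there f∈)    = proj₂ (above s p f∈)

  noLoops⇔inBrokenCircuitComplex : NoLoops (endpoints G) S ⇔ InBrokenCircuitComplex G S
  noLoops⇔inBrokenCircuitComplex = mk⇔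
    (λ ok B bc B⊆S → let (e , p) = brokenCircuit⇒joinedAbove bc (λ {x} → B⊆S {x}) in noLoops⇒¬joinedAbove G S ok e p)
    (λ inB → ¬joinedAbove⇒noLoops G S λ e p → joinedAbove⇒¬inBrokenCircuitComplex e p inB)

-- Acyclic orientations and their sinks.

module _ (G : Graph n m) (o : Orientation m) where

  private
    A = arcs (endpoints G) o []

  arc-∈ : ∀ e → arc G o e ∈ₗ A
  arc-∈ e = arcs-∈⁺ (endpoints G) o (inj₂ (e , ≡.refl))

  ∈-arc : ∀ {x} → x ∈ₗ A → ∃ λ e → arc G o e ≡ x
  ∈-arc i with arcs-∈⁻ (endpoints G) o i
  ... | inj₂ p = p

  directed⇒joins : ∀ {e a b} → Directed G o e a b → Joins G e a b
  directed⇒joins {e} eq with Vec.lookup o e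
  ... | true  = inj₁ eq
  ... | false = inj₂ (cong swap eq)

  directed? : ∀ e a b → Dec (Directed G o e a b)
  directed? e a b = _≟ᴱ_ G (arc G o e) (a , b)

  -- A return from the head of an arc to its tail is shortened to a path, which the arc closes to a
  -- directed cycle.
  acyclic⇒acyc : Acyclic G o → Acyc [] A
  acyclic⇒acyc acyclic = All.tabulate λ i r → no-cycle (∈-arc i) r
    where
    no-cycle : ∀ {a b} → (∃ λ e → Directed G o e a b) → ¬ Reach [] A b a
    no-cycle {a} {b} (e , eq) r = acyclic (a , (e , b) ∷ s ,
      s≤s z≤n , (eq , p) , All.tabulate fresh ∷ path-edges-unique G directed⇒joins s p unique , unique)
      where
      path : Path directed? b a
      path = let (s , p) = star⇒walk (Star.map (λ { (inj₂ (inj₂ i)) → ∈-arc i }) r) in walk⇒path directed? s p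

      s = proj₁ path
      p = proj₁ (proj₂ path)
      unique = proj₂ (proj₂ path)

      -- A second use of `e` would come back to its head `b`, where the path starts.
      fresh : ∀ {f} → f ∈ₗ edges s → e ≢ f
      fresh f∈ ≡.refl with walk-edge s p f∈ | unique
      ... | _ , _ , eq′ , _ , b∈ | b∉ ∷ _ = All.lookup b∉ b∈ (cong proj₂ (≡.trans (≡.sym eq) eq′))

  acyc⇒acyclic : Acyc [] A → Acyclic G o
  acyc⇒acyclic acyc (v , (e , w) ∷ s , _ , (eq , p) , _) =
    All.lookup acyc (arc-∈ e) (≡.subst (λ x → Reach [] A (proj₂ x) (proj₁ x)) (≡.sym eq)
      (Star.map (λ (f , eq′) → inj₂ (inj₂ (≡.subst (_∈ₗ A) eq′ (arc-∈ f)))) (walk⇒star s p)))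

  incident⇒ : ∀ {e v} → Incident G e v → v ≡ proj₁ (arc G o e) ⊎ v ≡ proj₂ (arc G o e)
  incident⇒ {e} inc with Vec.lookup o e | inc
  ... | true  | i      = i
  ... | false | inj₁ i = inj₂ i
  ... | false | inj₂ i = inj₁ i

  tail-incident : ∀ {e} → Incident G e (proj₁ (arc G o e))
  tail-incident {e} with Vec.lookup o e
  ... | true  = inj₁ ≡.refl
  ... | false = inj₂ ≡.refl

  -- An arc leaving a sink would also end there, and acyclicity excludes such a loop.
  sink⇒noExit : ∀ {v} → Acyc [] A → IsSink G o v → NoExit A ⁅ v ⁆
  sink⇒noExit {v} acyc sink = All.tabulate λ i → no-exit i (∈-arc i)
    where
    no-exit : ∀ {x} → x ∈ₗ A → (∃ λ e → arc G o e ≡ x) → proj₁ x ∉ ⁅ v ⁆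
    no-exit i (e , ≡.refl) t∈ with x∈⁅y⁆⇒x≡y v t∈
    ... | ≡.refl = All.lookup acyc i (≡.subst (λ h → Reach [] A h v) (≡.sym (sink e tail-incident)) ε)

  noExit⇒sink : ∀ {v} → NoExit A ⁅ v ⁆ → IsSink G o v
  noExit⇒sink {v} exit e inc with incident⇒ inc
  ... | inj₁ eq = ⊥-elim (All.lookup exit (arc-∈ e) (≡.subst (_∈ ⁅ v ⁆) eq (x∈⁅x⁆ v)))
  ... | inj₂ eq = ≡.sym eq

conn-[]⁻ : ∀ {a b : Fin n} → Conn [] a b → a ≡ b
conn-[]⁻ ε                     = ≡.refl
conn-[]⁻ (inj₁ () ◅ _)
conn-[]⁻ (inj₂ (inj₁ ()) ◅ _)
conn-[]⁻ (inj₂ (inj₂ ()) ◅ _)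

singleton-component : ∀ (v : Fin n) → Component [] ⁅ v ⁆
singleton-component v = (v , x∈⁅x⁆ v) , λ u u∈ w → mk⇔
  (λ w∈ → ≡.subst (Conn [] u) (≡.trans (x∈⁅y⁆⇒x≡y v u∈) (≡.sym (x∈⁅y⁆⇒x≡y v w∈))) ε)
  (λ p → ≡.subst (_∈ ⁅ v ⁆) (conn-[]⁻ p) u∈)

component-[]⇒singleton : ∀ {C : Subset n} → Component [] C → ∃ λ v → C ≡ ⁅ v ⁆
component-[]⇒singleton comp@((v , v∈) , _) = v ,
  ≡.trans (component-unique [] comp v∈) (≡.sym (component-unique [] (singleton-component v) (x∈⁅x⁆ v)))

-- The weights v_C and the two evaluations of the expansion.

module _ {n : ℕ} where
  open CommutativeRing (polyRing n) using (setoid; refl; sym; trans; reflexive;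
    *-identityˡ; *-identityʳ; *-commutativeMonoid; +-commutativeMonoid)
  open Fold *-commutativeMonoid
    using (fold-cong; fold-filter; fold-∙; fold-single; fold-singletons) renaming (fold to product)
  open Fold +-commutativeMonoid using () renaming (fold-cong to sum-cong; fold-filter to sum-filter)
  open SetoidReasoning setoid
  open Complement (polyRing n)

  -- This is the product that `componentWeight` subtracts from one; unlike the weight itself, it is
  -- multiplicative over disjoint unions.
  avoidance : Subset n → Poly n
  avoidance C = ∏[ filter (_∈? C) (allFin n) ] λ v → 1ᴾ -ᴾ var v

  avoidance-∪ : ∀ C D → (∀ {x} → x ∈ C → x ∉ D) → avoidance (C ∪ D) ≋ avoidance C *ᴾ avoidance D
  avoidance-∪ C D disj = begin
    avoidance (C ∪ D)
      ≈⟨ fold-filter (_∈? (C ∪ D)) (allFin n) ⟩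
    product (allFin n) (q∣ (C ∪ D))
      ≈⟨ fold-cong (allFin n) (λ v → split v (v ∈? (C ∪ D)) (v ∈? C) (v ∈? D)) ⟩
    product (allFin n) (λ v → q∣ C v *ᴾ q∣ D v)
      ≈⟨ fold-∙ (allFin n) {q∣ C} {q∣ D} ⟩
    product (allFin n) (q∣ C) *ᴾ product (allFin n) (q∣ D)
      ≈⟨ CommutativeRing.*-cong (polyRing n)
           (fold-filter (_∈? C) (allFin n)) (fold-filter (_∈? D) (allFin n)) ⟨
    avoidance C *ᴾ avoidance D ∎
    where
    q : Fin n → Poly n
    q v = 1ᴾ -ᴾ var v

    q∣ : Subset n → Fin n → Poly n
    q∣ S v = if does (v ∈? S) then q v else 1ᴾ

    split : ∀ v (u? : Dec (v ∈ C ∪ D)) (c? : Dec (v ∈ C)) (d? : Dec (v ∈ D)) →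
      (if does u? then q v else 1ᴾ) ≋ (if does c? then q v else 1ᴾ) *ᴾ (if does d? then q v else 1ᴾ)
    split v _        (yes c) (yes d) = ⊥-elim (disj c d)
    split v (yes _)  (yes _) (no _)  = sym (*-identityʳ (q v))
    split v (yes _)  (no _)  (yes _) = sym (*-identityˡ (q v))
    split v (yes u)  (no ¬c) (no ¬d) = ⊥-elim ([ ¬c , ¬d ]′ (x∈p∪q⁻ C D u))
    split v (no ¬u)  (yes c) (no _)  = ⊥-elim (¬u (x∈p∪q⁺ (inj₁ c)))
    split v (no ¬u)  (no _)  (yes d) = ⊥-elim (¬u (x∈p∪q⁺ (inj₂ d)))
    split v (no _)   (no _)  (no _)  = sym (*-identityˡ 1ᴾ)

  componentWeight-∪ : ∀ C D → (∀ {x} → x ∈ C → x ∉ D) →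
    componentWeight (C ∪ D) +ᴾ componentWeight C *ᴾ componentWeight D ≋
    componentWeight C +ᴾ componentWeight D
  componentWeight-∪ C D disj =
    complement-union (avoidance (C ∪ D)) (avoidance C) (avoidance D) (avoidance-∪ C D disj)

  componentWeight-singleton : ∀ v → componentWeight ⁅ v ⁆ ≋ var v
  componentWeight-singleton v = begin
    1ᴾ -ᴾ avoidance ⁅ v ⁆
      ≈⟨ complement-cong (avoidance ⁅ v ⁆) (product (allFin n) q) (fold-filter (_∈? ⁅ v ⁆) (allFin n)) ⟩
    1ᴾ -ᴾ product (allFin n) q
      ≈⟨ complement-cong (product (allFin n) q) (q v)
           (fold-single (Unique.allFin⁺ n) (∈-allFin v) off) ⟩
    1ᴾ -ᴾ q v
      ≡⟨ cong (1ᴾ -ᴾ_) (if-yes (v ∈? ⁅ v ⁆) (x∈⁅x⁆ v)) ⟩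
    1ᴾ -ᴾ (1ᴾ -ᴾ var v)
      ≈⟨ complement-involutive (var v) ⟩
    var v ∎
    where
    q : Fin n → Poly n
    q u = if does (u ∈? ⁅ v ⁆) then 1ᴾ -ᴾ var u else 1ᴾ

    off : ∀ u → u ≢ v → q u ≋ 1ᴾ
    off u u≢v = reflexive (if-no (u ∈? ⁅ v ⁆) (u≢v ∘ x∈⁅y⁆⇒x≡y v))

  open DeletionContraction (polyRing n) componentWeight componentWeight-∪

  module _ (G : Graph n m) where

    -- With nothing contracted the components are the single vertices, the exit-free ones are the
    -- sinks, and the weight of a singleton is its variable.
    orientation-weight : ∀ o →
      (if does (acyclic? G o) then ∏[ Sink G o ] var else 0ᴾ) ≋ weight [] (arcs (endpoints G) o [])
    orientation-weight o = by-cases (acyclic? G o)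
      where
      A = arcs (endpoints G) o []

      by-cases : (d : Dec (Acyclic G o)) → (if does d then ∏[ Sink G o ] var else 0ᴾ) ≋ weight [] A
      by-cases (no ¬acyclic) = sym (weight-¬acyc {[]} {A} (¬acyclic ∘ acyc⇒acyclic G o))
      by-cases (yes acyclic) = begin
        ∏[ Sink G o ] var
          ≈⟨ fold-filter (isSink? G o) (allFin n) ⟩
        product (allFin n) (λ v → if does (isSink? G o v) then var v else 1ᴾ)
          ≈⟨ fold-cong (allFin n) (λ v → vertex v (isSink? G o v)) ⟩
        product (allFin n) (λ v → factor [] A ⁅ v ⁆)
          ≈⟨ fold-singletons (λ C C≢ → factor-¬component λ comp →
               let (v , eq) = component-[]⇒singleton comp in C≢ v eq) ⟨
        sinkWeight [] A
          ≈⟨ weight-acyc acyc ⟨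
        weight [] A ∎
        where
        acyc : Acyc [] A
        acyc = acyclic⇒acyc G o acyclic

        vertex : ∀ v (d : Dec (IsSink G o v)) → (if does d then var v else 1ᴾ) ≋ factor [] A ⁅ v ⁆
        vertex v (yes sink) = sym (trans
          (factor-sink (singleton-component v) (sink⇒noExit G o acyc sink)) (componentWeight-singleton v))
        vertex v (no ¬sink) = sym (factor-exit {[]} (¬sink ∘ noExit⇒sink G o))

    -- Once every edge is contracted or deleted no arcs remain, so acyclicity and the absence of
    -- exits hold vacuously and every component contributes its weight.
    chosen-weight : ∀ S → weight (chosen (endpoints G) S) [] ≋ ∏[ components G S ] componentWeight
    chosen-weight S = begin
      weight (chosen (endpoints G) S) []
        ≈⟨ weight-acyc {chosen (endpoints G) S} {[]} [] ⟩
      sinkWeight (chosen (endpoints G) S) []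
        ≈⟨ fold-cong (allBoolVecs n) (λ C → factor≋ C (isComponent? G S C)) ⟩
      product (allBoolVecs n) (λ C → if does (isComponent? G S C) then componentWeight C else 1ᴾ)
        ≈⟨ fold-filter (isComponent? G S) (allBoolVecs n) ⟨
      ∏[ components G S ] componentWeight ∎
      where
      factor≋ : ∀ C (d : Dec (IsComponent G S C)) →
        factor (chosen (endpoints G) S) [] C ≋ (if does d then componentWeight C else 1ᴾ)
      factor≋ C (yes comp) = factor-sink (Equivalence.from (component⇔isComponent G) comp) []
      factor≋ C (no ¬comp) = factor-¬component (¬comp ∘ Equivalence.to (component⇔isComponent G))

    acyclicOrientationPolynomial-expansion : acyclicOrientationPolynomial G ≋
      (∑[ brokenCircuitComplex G ] λ S → ∏[ components G S ] componentWeight)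
    acyclicOrientationPolynomial-expansion = begin
      acyclicOrientationPolynomial G
        ≈⟨ sum-filter (acyclic? G) (allBoolVecs m) ⟩
      (∑[ allBoolVecs m ] λ o → if does (acyclic? G o) then ∏[ Sink G o ] var else 0ᴾ)
        ≈⟨ sum-cong (allBoolVecs m) orientation-weight ⟩
      (∑[ allBoolVecs m ] λ o → weight [] (arcs (endpoints G) o []))
        ≈⟨ expansion (endpoints G) [] ⟩
      (∑[ allBoolVecs m ] λ S → if does (noLoops? (endpoints G) S) then weight (chosen (endpoints G) S) [] else 0ᴾ)
        ≈⟨ sum-cong (allBoolVecs m) summand ⟩
      (∑[ allBoolVecs m ] λ S →
        if does (inBrokenCircuitComplex? G S) then ∏[ components G S ] componentWeight else 0ᴾ)
        ≈⟨ sum-filter (inBrokenCircuitComplex? G) (allBoolVecs m) ⟨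
      (∑[ brokenCircuitComplex G ] λ S → ∏[ components G S ] componentWeight) ∎
      where
      if-cong : ∀ b {p q : Poly n} → p ≋ q → (if b then p else 0ᴾ) ≋ (if b then q else 0ᴾ)
      if-cong true  eq = eq
      if-cong false _  = refl

      summand : ∀ S →
        (if does (noLoops? (endpoints G) S) then weight (chosen (endpoints G) S) [] else 0ᴾ) ≋
        (if does (inBrokenCircuitComplex? G S) then ∏[ components G S ] componentWeight else 0ᴾ)
      summand S = trans
        (if-cong (does (noLoops? (endpoints G) S)) (chosen-weight S))
        (reflexive (cong (if_then ∏[ components G S ] componentWeight else 0ᴾ)
          (does-⇔ (noLoops⇔inBrokenCircuitComplex G S)
            (noLoops? (endpoints G) S) (inBrokenCircuitComplex? G S))))

theorem3p5 : (n m : ℕ) (G : Graph n m) →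
    acyclicOrientationPolynomial G ≈
    (∑[ brokenCircuitComplex G ] λ S → ∏[ components G S ] componentWeight)
theorem3p5 n m G = ≋⇒≈ (acyclicOrientationPolynomial-expansion G)
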